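{- Let $q$ be a prime power and let $A\subseteq\mathbb{F}_q$. Let $E^+(A)$ denote the number of quadruples $(a,b,c,d)\in A^4$ with $a+b=c+d$. Suppose that $E^+(A)\le \frac{|A|^3}{K}$ for some $K>0$ and that $|A|\ge K^{1/3}q^{2/3}$. Then \[|[A,A,0][A,A,0]|\gg Kq\,|[A,A,0]|.\]
   Context: For a field $F$ and $n\ge1$, the Heisenberg group $H_n(F)$ is the group (under matrix multiplication) of $(n+2)\times(n+2)$ matrices \[[\mathbf{x},\mathbf{y},z]=\begin{bmatrix}1&\mathbf{x}&z\\ \mathbf{0}&I_n&\mathbf{y}^t\\ 0&\mathbf{0}&1\end{bmatrix},\qquad \mathbf{x},\mathbf{y}\in F^n,\ z\in F,\] where $\mathbf{y}^t$ is the column vector of $\mathbf{y}$ and $I_n$ the identity matrix; explicitly $[\mathbf{x},\mathbf{y},z][\mathbf{x}',\mathbf{y}',z']=[\mathbf{x}+\mathbf{x}',\mathbf{y}+\mathbf{y}',z+z'+\mathbf{x}\cdot\mathbf{y}']$. For $E,F'\subseteq F^n$ and $Z\subseteq F$, $[E,F',Z]=\{[\mathbf{x},\mathbf{y},z]:\mathbf{x}\in E,\mathbf{y}\in F',z\in Z\}$, and $[E,F',Z][E,F',Z]$ is the set of all products $mm'$ with $m,m'\in[E,F',Z]$; $[A,A,0]$ means $[A,A,\{0\}]$ (here $n=1$). $X\ll Y$ (equivalently $Y\gg X$) means $X\le CY$ for an absolute constant $C>0$ independent of all parameters. -}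

module Defs where

open import Level using (0ℓ)
open import Data.Nat using (ℕ)
open import Data.Bool using (Bool; true; false; _∧_; if_then_else_)
open import Data.Fin using (Fin)
open import Data.List using (List; []; _∷_; map; filter; length; concatMap; allFin)
open import Data.Bool.ListAction using (any)
open import Data.Integer using (+_)
open import Data.Rational using (ℚ; _/_)
open import Data.Product using (_×_; _,_; Σ)
open import Relation.Binary.PropositionalEquality using (_≡_)
open import Relation.Binary.Definitions using (DecidableEquality)
open import Relation.Nullary using (¬_)
open import Relation.Nullary.Decidable using (⌊_⌋)
open import Function.Bundles using (_↔_; Inverse)
open import Algebra.Structures using (IsCommutativeRing)

-- A finite field: a commutative ring (with propositional equality) in which
-- 0 ≠ 1 and every nonzero element has a multiplicative inverse, together with
-- decidable equality and an explicit bijection Fin size ↔ Carrier.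
-- (Every finite field has prime-power order q = size, and every prime power
-- occurs, so quantifying over these records = quantifying over all 𝔽_q.)
record FiniteField : Set₁ where
  infixl 6 _+_
  infixl 7 _*_
  field
    Carrier : Set
    _+_ _*_ : Carrier → Carrier → Carrier
    -_      : Carrier → Carrier
    0# 1#   : Carrier
    isCommutativeRing : IsCommutativeRing _≡_ _+_ _*_ -_ 0# 1#
    0≢1     : ¬ (0# ≡ 1#)
    inverse : ∀ x → ¬ (x ≡ 0#) → Σ Carrier (λ y → x * y ≡ 1#)
    _≟_     : DecidableEquality Carrier
    size    : ℕ
    enum    : Fin size ↔ Carrier

ℕ→ℚ : ℕ → ℚ
ℕ→ℚ n = (+ n) / 1

module _ (F : FiniteField) where
  open FiniteField F

  elems : List Carrier
  elems = map (Inverse.to enum) (allFin size)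

  _==_ : Carrier → Carrier → Bool
  x == y = ⌊ x ≟ y ⌋

  card : (Carrier → Bool) → ℕ
  card A = length (filter (λ x → A x ≟ᵇ true) elems)
    where
      open import Data.Bool.Properties using () renaming (_≟_ to _≟ᵇ_)

  addEnergy : (Carrier → Bool) → ℕ
  addEnergy A = length
    (filter (λ t → t ≟ᵇ true)
      (concatMap (λ a → concatMap (λ b → concatMap (λ c → map (λ d →
          A a ∧ A b ∧ A c ∧ A d ∧ ((a + b) == (c + d))) elems) elems) elems) elems))
    where
      open import Data.Bool.Properties using () renaming (_≟_ to _≟ᵇ_)

  Heis : Set
  Heis = Carrier × Carrier × Carrier

  hmul : Heis → Heis → Heis
  hmul (x , y , z) (x' , y' , z') = (x + x' , y + y' , z + z' + x * y')

  _==H_ : Heis → Heis → Bool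
  (x , y , z) ==H (x' , y' , z') = (x == x') ∧ (y == y') ∧ (z == z')

  heisElems : List Heis
  heisElems = concatMap (λ x → concatMap (λ y → map (λ z → (x , y , z)) elems) elems) elems

  inAA0 : (Carrier → Bool) → Heis → Bool
  inAA0 A (x , y , z) = A x ∧ A y ∧ (z == 0#)

  inProd : (Carrier → Bool) → Heis → Bool
  inProd A g = any (λ m → any (λ m' → inAA0 A m ∧ inAA0 A m' ∧ (hmul m m' ==H g)) heisElems) heisElems

  countH : (Heis → Bool) → ℕ
  countH P = length (filter (λ g → P g ≟ᵇ true) heisElems)
    where
      open import Data.Bool.Properties using () renaming (_≟_ to _≟ᵇ_)

  cardAA0 : (Carrier → Bool) → ℕ
  cardAA0 A = countH (inAA0 A)

  cardProd : (Carrier → Bool) → ℕ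
  cardProd A = countH (inProd A)

{-# OPTIONS --safe #-}
module Submission where

-- With n = |A| and B = A ∖ {0}, consider the products [x, b, 0][a, y, 0] with x, y ∈ B and a, b ∈ A.
-- By Cauchy–Schwarz it suffices to bound the number of their collisions, that is of the solutions of
-- x + a = x′ + a′, y + b = y′ + b′, x y = x′ y′. Sorting them by the ratio l = x′/x = y/y′ bounds
-- this number by Σ_l H(l)², where H(l) counts the solutions of x + a = l x + a′ with l x ∈ B. Then
-- Σ_l H(l) ≤ E⁺(A). Forgetting that l x ∈ B gives H ≤ H′, where H′(l) counts incidences between A
-- and the lines s = l x + a′ − x. Two such lines meet at most once, so a second moment computation
-- shows that H′ deviates from its mean (at most n³/q) by at most q n³ in square sum. Hence
-- Σ_l H(l)² ≤ 2 (n³/q) E⁺(A) + q n³, and both terms are O(n⁶/(Kq)) by the two hypotheses.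
open import Defs
open import Algebra.Bundles using (CommutativeRing)
open import Data.Bool using (Bool; true; false; _∧_; not)
open import Data.Bool.ListAction using (any)
open import Data.Bool.Properties using () renaming (_≟_ to _≟ᵇ_)
open import Data.Fin using (Fin)
import Data.Integer as ℤ
import Data.Integer.Properties as ℤ
open import Data.List using (List; []; _∷_; map; filter; length; concatMap; allFin; cartesianProduct; _++_)
open import Data.List.Membership.Propositional using (_∈_)
open import Data.List.Membership.Propositional.Properties using (∈-map⁺; ∈-allFin)
open import Data.List.Properties using (map-++; map-∘; length-map; length-tabulate)
open import Data.List.Relation.Unary.All as All using (All; []; _∷_)
open import Data.List.Relation.Unary.AllPairs using (_∷_)
open import Data.List.Relation.Unary.Any using (here; there)
open import Data.List.Relation.Unary.Unique.Propositional using (Unique)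
open import Data.List.Relation.Unary.Unique.Propositional.Properties using (map⁺; allFin⁺)
open import Data.Nat using (ℕ; zero; suc; z≤n; s≤s; NonZero; >-nonZero⁻¹) renaming (_+_ to _+ⁿ_; _*_ to _*ⁿ_; _≤_ to _≤ⁿ_)
open import Data.Nat.Coprimality using (Coprime)
open import Data.Nat.ListAction using (sum)
open import Data.Nat.ListAction.Properties using (sum-++)
import Data.Nat.Properties as ℕ
open import Data.Nat.Tactic.RingSolver using (solve-∀)
open import Data.Product using (Σ; _×_; _,_; proj₁; proj₂)
import Data.Rational.Properties as ℚ
open import Data.Rational.Unnormalised using (mkℚᵘ) renaming (_*_ to _*ᵘ_; _≃_ to _≃ᵘ_; *≤* to *≤*ᵘ; *≡* to *≡*ᵘ)
import Data.Rational.Unnormalised.Properties as ℚᵘ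
open import Function.Base using (it)
open import Function.Bundles using (Inverse; Injection)
open import Function.Properties.Inverse using (Inverse⇒Injection)
open import Level using (0ℓ)
open import Relation.Binary.PropositionalEquality using (_≡_; _≢_; refl; sym; trans; cong; cong₂; subst; subst₂; module ≡-Reasoning)
open import Relation.Nullary using (yes; no; contradiction)

-- Finite sums over lists.

private variable
  X Y : Set

∑ : List X → (X → ℕ) → ℕ
∑ xs f = sum (map f xs)

syntax ∑ xs (λ x → e) = ∑[ x ∈ xs ] e
infix 5 ∑

∑-cong : ∀ (xs : List X) {f g : X → ℕ} → (∀ x → f x ≡ g x) → ∑ xs f ≡ ∑ xs g
∑-cong []       f≡g = refl
∑-cong (x ∷ xs) f≡g = cong₂ _+ⁿ_ (f≡g x) (∑-cong xs f≡g)

∑-mono : ∀ (xs : List X) {f g : X → ℕ} → (∀ x → f x ≤ⁿ g x) → ∑ xs f ≤ⁿ ∑ xs g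
∑-mono []       f≤g = z≤n
∑-mono (x ∷ xs) f≤g = ℕ.+-mono-≤ (f≤g x) (∑-mono xs f≤g)

∑-zero : ∀ (xs : List X) → ∑[ x ∈ xs ] 0 ≡ 0
∑-zero []       = refl
∑-zero (x ∷ xs) = ∑-zero xs

∑-const : ∀ (xs : List X) c → ∑[ x ∈ xs ] c ≡ length xs *ⁿ c
∑-const []       c = refl
∑-const (x ∷ xs) c = cong (c +ⁿ_) (∑-const xs c)

∑-+ : ∀ (xs : List X) (f g : X → ℕ) → ∑[ x ∈ xs ] (f x +ⁿ g x) ≡ ∑ xs f +ⁿ ∑ xs g
∑-+ []       f g = refl
∑-+ (x ∷ xs) f g = trans (cong (f x +ⁿ g x +ⁿ_) (∑-+ xs f g)) (interchange (f x) (g x) (∑ xs f) (∑ xs g))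
  where
  interchange : ∀ a b c d → a +ⁿ b +ⁿ (c +ⁿ d) ≡ a +ⁿ c +ⁿ (b +ⁿ d)
  interchange = solve-∀

∑-*ˡ : ∀ (xs : List X) c (f : X → ℕ) → ∑[ x ∈ xs ] (c *ⁿ f x) ≡ c *ⁿ ∑ xs f
∑-*ˡ []       c f = sym (ℕ.*-zeroʳ c)
∑-*ˡ (x ∷ xs) c f = trans (cong (c *ⁿ f x +ⁿ_) (∑-*ˡ xs c f)) (sym (ℕ.*-distribˡ-+ c (f x) (∑ xs f)))

∑-*ʳ : ∀ (xs : List X) c (f : X → ℕ) → ∑[ x ∈ xs ] (f x *ⁿ c) ≡ ∑ xs f *ⁿ c
∑-*ʳ xs c f = trans (∑-cong xs (λ x → ℕ.*-comm (f x) c)) (trans (∑-*ˡ xs c f) (ℕ.*-comm c (∑ xs f)))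

∑-swap : ∀ (xs : List X) (ys : List Y) (f : X → Y → ℕ)
  → ∑[ x ∈ xs ] ∑[ y ∈ ys ] f x y ≡ ∑[ y ∈ ys ] ∑[ x ∈ xs ] f x y
∑-swap []       ys f = sym (∑-zero ys)
∑-swap (x ∷ xs) ys f = trans (cong (∑ ys (f x) +ⁿ_) (∑-swap xs ys f)) (sym (∑-+ ys (f x) (λ y → ∑[ x ∈ xs ] f x y)))

∑-*∑ : ∀ (xs : List X) (ys : List Y) (f : X → ℕ) (g : Y → ℕ)
  → ∑[ x ∈ xs ] ∑[ y ∈ ys ] (f x *ⁿ g y) ≡ ∑ xs f *ⁿ ∑ ys g
∑-*∑ xs ys f g = trans (∑-cong xs (λ x → ∑-*ˡ ys (f x) g)) (∑-*ʳ xs (∑ ys g) f)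

∑-++ : ∀ (xs ys : List X) (f : X → ℕ) → ∑ (xs ++ ys) f ≡ ∑ xs f +ⁿ ∑ ys f
∑-++ xs ys f = trans (cong sum (map-++ f xs ys)) (sum-++ (map f xs) (map f ys))

∑-map : ∀ (xs : List X) (h : X → Y) (f : Y → ℕ) → ∑ (map h xs) f ≡ ∑[ x ∈ xs ] f (h x)
∑-map xs h f = cong sum (sym (map-∘ xs))

∑-concatMap : ∀ (xs : List X) (h : X → List Y) (f : Y → ℕ) → ∑ (concatMap h xs) f ≡ ∑[ x ∈ xs ] ∑ (h x) f
∑-concatMap []       h f = refl
∑-concatMap (x ∷ xs) h f = trans (∑-++ (h x) (concatMap h xs) f) (cong (∑ (h x) f +ⁿ_) (∑-concatMap xs h f))

∑-cartesianProduct : ∀ (xs : List X) (ys : List Y) (f : X × Y → ℕ)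
  → ∑ (cartesianProduct xs ys) f ≡ ∑[ x ∈ xs ] ∑[ y ∈ ys ] f (x , y)
∑-cartesianProduct []       ys f = refl
∑-cartesianProduct (x ∷ xs) ys f =
  trans (∑-++ (map (x ,_) ys) (cartesianProduct xs ys) f) (cong₂ _+ⁿ_ (∑-map ys (x ,_) f) (∑-cartesianProduct xs ys f))

-- Cauchy-Schwarz in the natural numbers.

-- Lowering a and b together by one keeps the difference (a - b)² of the two sides unchanged, until
-- one of them is 0.
2ab≤a²+b² : ∀ a b → 2 *ⁿ (a *ⁿ b) ≤ⁿ a *ⁿ a +ⁿ b *ⁿ b
2ab≤a²+b² zero    b       = z≤n
2ab≤a²+b² (suc a) zero    = ℕ.≤-trans (ℕ.≤-reflexive (cong (2 *ⁿ_) (ℕ.*-zeroʳ a))) z≤n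
2ab≤a²+b² (suc a) (suc b) = begin
  2 *ⁿ (suc a *ⁿ suc b)                 ≡⟨ expandˡ a b ⟩
  2 *ⁿ (a *ⁿ b) +ⁿ (2 *ⁿ a +ⁿ 2 *ⁿ b +ⁿ 2)   ≤⟨ ℕ.+-monoˡ-≤ _ (2ab≤a²+b² a b) ⟩
  a *ⁿ a +ⁿ b *ⁿ b +ⁿ (2 *ⁿ a +ⁿ 2 *ⁿ b +ⁿ 2) ≡⟨ expandʳ a b ⟩
  suc a *ⁿ suc a +ⁿ suc b *ⁿ suc b       ∎
  where
  open ℕ.≤-Reasoning
  expandˡ : ∀ a b → 2 *ⁿ (suc a *ⁿ suc b) ≡ 2 *ⁿ (a *ⁿ b) +ⁿ (2 *ⁿ a +ⁿ 2 *ⁿ b +ⁿ 2)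
  expandˡ = solve-∀
  expandʳ : ∀ a b → a *ⁿ a +ⁿ b *ⁿ b +ⁿ (2 *ⁿ a +ⁿ 2 *ⁿ b +ⁿ 2) ≡ suc a *ⁿ suc a +ⁿ suc b *ⁿ suc b
  expandʳ = solve-∀

-- Doubled, the left side is a sum over pairs (x, y), each governed by `2ab≤a²+b²` scaled by w x w
-- y. In the uses w is an indicator, so the first factor on the right counts its support.
cauchy-schwarz : ∀ (xs : List X) (w f : X → ℕ)
  → (∑[ x ∈ xs ] (w x *ⁿ f x)) *ⁿ (∑[ x ∈ xs ] (w x *ⁿ f x)) ≤ⁿ ∑ xs w *ⁿ (∑[ x ∈ xs ] (w x *ⁿ (f x *ⁿ f x)))
cauchy-schwarz xs w f = ℕ.*-cancelˡ-≤ 2 (begin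
  2 *ⁿ (S₁ *ⁿ S₁)
    ≡⟨ cong (2 *ⁿ_) (∑-*∑ xs xs _ _) ⟨
  2 *ⁿ (∑[ x ∈ xs ] ∑[ y ∈ xs ] (w x *ⁿ f x *ⁿ (w y *ⁿ f y)))
    ≡⟨ trans (sym (∑-*ˡ xs 2 _)) (∑-cong xs (λ x → sym (∑-*ˡ xs 2 _))) ⟩
  ∑[ x ∈ xs ] ∑[ y ∈ xs ] (2 *ⁿ (w x *ⁿ f x *ⁿ (w y *ⁿ f y)))
    ≤⟨ ∑-mono xs (λ x → ∑-mono xs (λ y → pointwise (w x) (f x) (w y) (f y))) ⟩
  ∑[ x ∈ xs ] ∑[ y ∈ xs ] (w x *ⁿ (f x *ⁿ f x) *ⁿ w y +ⁿ w x *ⁿ (w y *ⁿ (f y *ⁿ f y)))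
    ≡⟨ trans (∑-cong xs (λ x → ∑-+ xs _ _)) (∑-+ xs _ _) ⟩
  (∑[ x ∈ xs ] ∑[ y ∈ xs ] (w x *ⁿ (f x *ⁿ f x) *ⁿ w y)) +ⁿ (∑[ x ∈ xs ] ∑[ y ∈ xs ] (w x *ⁿ (w y *ⁿ (f y *ⁿ f y))))
    ≡⟨ cong₂ _+ⁿ_ (∑-*∑ xs xs _ _) (∑-*∑ xs xs _ _) ⟩
  S₂ *ⁿ S₀ +ⁿ S₀ *ⁿ S₂
    ≡⟨ double S₀ S₂ ⟩
  2 *ⁿ (S₀ *ⁿ S₂) ∎)
  where
  open ℕ.≤-Reasoning
  S₀ = ∑ xs w
  S₁ = ∑[ x ∈ xs ] (w x *ⁿ f x)
  S₂ = ∑[ x ∈ xs ] (w x *ⁿ (f x *ⁿ f x))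
  double : ∀ a b → b *ⁿ a +ⁿ a *ⁿ b ≡ 2 *ⁿ (a *ⁿ b)
  double = solve-∀
  pointwise : ∀ u a v b → 2 *ⁿ (u *ⁿ a *ⁿ (v *ⁿ b)) ≤ⁿ u *ⁿ (a *ⁿ a) *ⁿ v +ⁿ u *ⁿ (v *ⁿ (b *ⁿ b))
  pointwise u a v b = begin
    2 *ⁿ (u *ⁿ a *ⁿ (v *ⁿ b))                 ≡⟨ collect u a v b ⟩
    u *ⁿ v *ⁿ (2 *ⁿ (a *ⁿ b))                 ≤⟨ ℕ.*-monoʳ-≤ (u *ⁿ v) (2ab≤a²+b² a b) ⟩
    u *ⁿ v *ⁿ (a *ⁿ a +ⁿ b *ⁿ b)               ≡⟨ spread u a v b ⟩
    u *ⁿ (a *ⁿ a) *ⁿ v +ⁿ u *ⁿ (v *ⁿ (b *ⁿ b))   ∎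
    where
    collect : ∀ u a v b → 2 *ⁿ (u *ⁿ a *ⁿ (v *ⁿ b)) ≡ u *ⁿ v *ⁿ (2 *ⁿ (a *ⁿ b))
    collect = solve-∀
    spread : ∀ u a v b → u *ⁿ v *ⁿ (a *ⁿ a +ⁿ b *ⁿ b) ≡ u *ⁿ (a *ⁿ a) *ⁿ v +ⁿ u *ⁿ (v *ⁿ (b *ⁿ b))
    spread = solve-∀

-- A vanishing c makes the claim trivial. With c an indicator or a weight, the condition it encodes
-- becomes available in the proof of m ≤ n.
*-monoʳ-≤-if : ∀ c {m n} → (1 ≤ⁿ c → m ≤ⁿ n) → c *ⁿ m ≤ⁿ c *ⁿ n
*-monoʳ-≤-if zero    m≤n = z≤n
*-monoʳ-≤-if (suc c) m≤n = ℕ.*-monoʳ-≤ (suc c) (m≤n (s≤s z≤n))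

1≤m*n⇒1≤m : ∀ m n → 1 ≤ⁿ m *ⁿ n → 1 ≤ⁿ m
1≤m*n⇒1≤m (suc m) n _ = s≤s z≤n

1≤m*n⇒1≤n : ∀ m n → 1 ≤ⁿ m *ⁿ n → 1 ≤ⁿ n
1≤m*n⇒1≤n m n h = 1≤m*n⇒1≤m n m (ℕ.≤-trans h (ℕ.≤-reflexive (ℕ.*-comm m n)))

-- Each fibre of φ is counted through D, the indicator of equality on Y.
cauchy-schwarz-collisions : ∀ (is : List X) (ys : List Y) (D : Y → Y → ℕ)
  → (∀ c (f : Y → ℕ) → ∑[ y ∈ ys ] (D c y *ⁿ f y) ≡ f c)
  → (W : X → ℕ) (φ : X → Y) (P : Y → ℕ) → (∀ y → P y ≤ⁿ 1) → (∀ i → 1 ≤ⁿ W i → 1 ≤ⁿ P (φ i))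
  → ∑ is W *ⁿ ∑ is W ≤ⁿ ∑ ys P *ⁿ (∑[ i ∈ is ] ∑[ j ∈ is ] (W i *ⁿ W j *ⁿ D (φ j) (φ i)))
cauchy-schwarz-collisions is ys D pick W φ P P≤1 W⇒P = begin
  ∑ is W *ⁿ ∑ is W
    ≤⟨ ℕ.*-mono-≤ W≤Pρ W≤Pρ ⟩
  (∑[ y ∈ ys ] (P y *ⁿ ρ y)) *ⁿ (∑[ y ∈ ys ] (P y *ⁿ ρ y))
    ≤⟨ cauchy-schwarz ys P ρ ⟩
  ∑ ys P *ⁿ (∑[ y ∈ ys ] (P y *ⁿ (ρ y *ⁿ ρ y)))
    ≤⟨ ℕ.*-monoʳ-≤ (∑ ys P) (∑-mono ys (λ y → ℕ.≤-trans (ℕ.*-monoˡ-≤ (ρ y *ⁿ ρ y) (P≤1 y)) (ℕ.≤-reflexive (ℕ.*-identityˡ _)))) ⟩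
  ∑ ys P *ⁿ (∑[ y ∈ ys ] (ρ y *ⁿ ρ y))
    ≡⟨ cong (∑ ys P *ⁿ_) ρ² ⟩
  ∑ ys P *ⁿ (∑[ i ∈ is ] ∑[ j ∈ is ] (W i *ⁿ W j *ⁿ D (φ j) (φ i))) ∎
  where
  open ℕ.≤-Reasoning
  ρ : _ → ℕ
  ρ y = ∑[ i ∈ is ] (W i *ⁿ D (φ i) y)
  -- Where W i is positive, P (φ i) is at least 1, so inserting it as a factor loses nothing.
  W≤WP : ∀ i → W i ≤ⁿ W i *ⁿ P (φ i)
  W≤WP i = ℕ.≤-trans (ℕ.≤-reflexive (sym (ℕ.*-identityʳ (W i)))) (*-monoʳ-≤-if (W i) (W⇒P i))
  W≤Pρ : ∑ is W ≤ⁿ ∑[ y ∈ ys ] (P y *ⁿ ρ y)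
  W≤Pρ = begin
    ∑ is W                                              ≤⟨ ∑-mono is W≤WP ⟩
    ∑[ i ∈ is ] (W i *ⁿ P (φ i))                         ≡⟨ ∑-cong is (λ i → cong (W i *ⁿ_) (sym (pick (φ i) P))) ⟩
    ∑[ i ∈ is ] (W i *ⁿ (∑[ y ∈ ys ] (D (φ i) y *ⁿ P y))) ≡⟨ ∑-cong is (λ i → sym (∑-*ˡ ys (W i) _)) ⟩
    ∑[ i ∈ is ] ∑[ y ∈ ys ] (W i *ⁿ (D (φ i) y *ⁿ P y))   ≡⟨ ∑-swap is ys _ ⟩
    ∑[ y ∈ ys ] ∑[ i ∈ is ] (W i *ⁿ (D (φ i) y *ⁿ P y))   ≡⟨ ∑-cong ys (λ y → trans (∑-cong is (λ i → rearrange (W i) _ (P y))) (∑-*ˡ is (P y) _)) ⟩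
    ∑[ y ∈ ys ] (P y *ⁿ ρ y)                             ∎
    where
    rearrange : ∀ a b c → a *ⁿ (b *ⁿ c) ≡ c *ⁿ (a *ⁿ b)
    rearrange = solve-∀
  ρ² : ∑[ y ∈ ys ] (ρ y *ⁿ ρ y) ≡ ∑[ i ∈ is ] ∑[ j ∈ is ] (W i *ⁿ W j *ⁿ D (φ j) (φ i))
  ρ² = begin-equality
    ∑[ y ∈ ys ] (ρ y *ⁿ ρ y)
      ≡⟨ ∑-cong ys (λ y → sym (∑-*∑ is is _ _)) ⟩
    ∑[ y ∈ ys ] ∑[ i ∈ is ] ∑[ j ∈ is ] (W i *ⁿ D (φ i) y *ⁿ (W j *ⁿ D (φ j) y))
      ≡⟨ ∑-swap ys is _ ⟩
    ∑[ i ∈ is ] ∑[ y ∈ ys ] ∑[ j ∈ is ] (W i *ⁿ D (φ i) y *ⁿ (W j *ⁿ D (φ j) y))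
      ≡⟨ ∑-cong is (λ i → ∑-swap ys is _) ⟩
    ∑[ i ∈ is ] ∑[ j ∈ is ] ∑[ y ∈ ys ] (W i *ⁿ D (φ i) y *ⁿ (W j *ⁿ D (φ j) y))
      ≡⟨ ∑-cong is (λ i → ∑-cong is (λ j → ∑-cong ys (λ y → rearrange (W i) (D (φ i) y) (W j) (D (φ j) y)))) ⟩
    ∑[ i ∈ is ] ∑[ j ∈ is ] ∑[ y ∈ ys ] (W i *ⁿ W j *ⁿ (D (φ i) y *ⁿ D (φ j) y))
      ≡⟨ ∑-cong is (λ i → ∑-cong is (λ j → trans (∑-*ˡ ys (W i *ⁿ W j) _) (cong (W i *ⁿ W j *ⁿ_) (pick (φ i) (D (φ j)))))) ⟩
    ∑[ i ∈ is ] ∑[ j ∈ is ] (W i *ⁿ W j *ⁿ D (φ j) (φ i)) ∎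
    where
    rearrange : ∀ a b c d → a *ⁿ b *ⁿ (c *ⁿ d) ≡ a *ⁿ c *ⁿ (b *ⁿ d)
    rearrange = solve-∀

-- Indicators of Boolean conditions.

𝟙 : Bool → ℕ
𝟙 true  = 1
𝟙 false = 0

𝟙≤1 : ∀ b → 𝟙 b ≤ⁿ 1
𝟙≤1 true  = ℕ.≤-refl
𝟙≤1 false = z≤n

𝟙-∧ : ∀ a b → 𝟙 (a ∧ b) ≡ 𝟙 a *ⁿ 𝟙 b
𝟙-∧ true  b = sym (ℕ.+-identityʳ (𝟙 b))
𝟙-∧ false b = refl

1≤𝟙⇒true : ∀ {b} → 1 ≤ⁿ 𝟙 b → b ≡ true
1≤𝟙⇒true {true} _ = refl

length-filter≡∑𝟙 : ∀ (P : X → Bool) xs → length (filter (λ x → P x ≟ᵇ true) xs) ≡ ∑[ x ∈ xs ] 𝟙 (P x)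
length-filter≡∑𝟙 P []       = refl
length-filter≡∑𝟙 P (x ∷ xs) with P x
... | true  = cong suc (length-filter≡∑𝟙 P xs)
... | false = length-filter≡∑𝟙 P xs

∑𝟙⇒any : ∀ (p : X → Bool) xs → 1 ≤ⁿ ∑[ x ∈ xs ] 𝟙 (p x) → any p xs ≡ true
∑𝟙⇒any p (x ∷ xs) h with p x
... | true  = refl
... | false = ∑𝟙⇒any p xs h

∑-pick-absent : ∀ {xs : List X} {c} (d f : X → ℕ) → (∀ {x} → c ≢ x → d x ≡ 0) → All (c ≢_) xs
  → ∑[ x ∈ xs ] (d x *ⁿ f x) ≡ 0
∑-pick-absent d f off []          = refl
∑-pick-absent d f off (c≢x ∷ c≢s) rewrite off c≢x = ∑-pick-absent d f off c≢s

-- Terms away from c vanish, and `Unique` lets c occur only once, so a single term survives.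
∑-pick : ∀ {xs : List X} {c} (d f : X → ℕ) → d c ≡ 1 → (∀ {x} → c ≢ x → d x ≡ 0)
  → Unique xs → c ∈ xs → ∑[ x ∈ xs ] (d x *ⁿ f x) ≡ f c
∑-pick {c = c} d f on off (c≢s ∷ _) (here refl)
  rewrite on | ∑-pick-absent d f off c≢s = trans (ℕ.+-identityʳ (f c +ⁿ 0)) (ℕ.+-identityʳ (f c))
∑-pick {xs = x ∷ xs} d f on off (x≢s ∷ u) (there c∈xs)
  rewrite off (λ c≡x → All.lookup x≢s c∈xs (sym c≡x)) = ∑-pick d f on off u c∈xs

-- Counting over a finite field.

module FieldSums (F : FiniteField) where
  open FiniteField F public

  commutativeRing : CommutativeRing 0ℓ 0ℓ
  commutativeRing = record { isCommutativeRing = isCommutativeRing }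

  open CommutativeRing commutativeRing public
    using (+-assoc; +-comm; +-identityˡ; +-identityʳ; *-assoc; *-comm; *-identityʳ; distribˡ; -‿inverseˡ; -‿inverseʳ)
  open import Algebra.Properties.Ring (CommutativeRing.ring commutativeRing) public
    using (+-cancelˡ; +-cancelʳ)

  *-cancelʳ : ∀ {x} → x ≢ 0# → ∀ a b → a * x ≡ b * x → a ≡ b
  *-cancelʳ {x} x≢0 a b ax≡bx with y , xy≡1 ← inverse x x≢0 = begin
    a           ≡⟨ undo a ⟨
    a * x * y   ≡⟨ cong (_* y) ax≡bx ⟩
    b * x * y   ≡⟨ undo b ⟩
    b           ∎
    where
    open ≡-Reasoning
    undo : ∀ c → c * x * y ≡ c
    undo c = trans (*-assoc c x y) (trans (cong (c *_) xy≡1) (*-identityʳ c))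

  division : ∀ {x} → x ≢ 0# → ∀ c → Σ Carrier (λ l → l * x ≡ c)
  division {x} x≢0 c with y , xy≡1 ← inverse x x≢0 =
    c * y , trans (*-assoc c y x) (trans (cong (c *_) (trans (*-comm y x) xy≡1)) (*-identityʳ c))

  δ : Carrier → Carrier → ℕ
  δ x y = 𝟙 (_==_ F x y)

  δ≤1 : ∀ x y → δ x y ≤ⁿ 1
  δ≤1 x y = 𝟙≤1 (_==_ F x y)

  ==⇒≡ : ∀ {x y} → _==_ F x y ≡ true → x ≡ y
  ==⇒≡ {x} {y} h with x ≟ y
  ... | yes x≡y = x≡y

  δ-≡ : ∀ {x y} → x ≡ y → δ x y ≡ 1
  δ-≡ {x} {y} x≡y with x ≟ y
  ... | yes _   = refl
  ... | no  x≢y = contradiction x≡y x≢y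

  δ-≢ : ∀ {x y} → x ≢ y → δ x y ≡ 0
  δ-≢ {x} {y} x≢y with x ≟ y
  ... | yes x≡y = contradiction x≡y x≢y
  ... | no  _   = refl

  δ*≤ : ∀ {x y m n} → (x ≡ y → m ≤ⁿ n) → δ x y *ⁿ m ≤ⁿ n
  δ*≤ {x} {y} {m} m≤n with x ≟ y
  ... | yes x≡y = ℕ.≤-trans (ℕ.≤-reflexive (ℕ.*-identityˡ m)) (m≤n x≡y)
  ... | no  _   = z≤n

  δ≤ : ∀ {x y n} → (x ≡ y → 1 ≤ⁿ n) → δ x y ≤ⁿ n
  δ≤ {x} {y} 1≤n = ℕ.≤-trans (ℕ.≤-reflexive (sym (ℕ.*-identityʳ (δ x y)))) (δ*≤ {x} {y} 1≤n)

  δ-cong : ∀ {x y x′ y′} → (x ≡ y → x′ ≡ y′) → (x′ ≡ y′ → x ≡ y) → δ x y ≡ δ x′ y′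
  δ-cong to from = ℕ.≤-antisym (δ≤ (λ e → ℕ.≤-reflexive (sym (δ-≡ (to e))))) (δ≤ (λ e → ℕ.≤-reflexive (sym (δ-≡ (from e)))))

  L : List Carrier
  L = elems F

  length-L : length L ≡ size
  length-L = trans (length-map (Inverse.to enum) (allFin size)) (length-tabulate (λ i → i))

  L-unique : Unique L
  L-unique = map⁺ (Injection.injective (Inverse⇒Injection enum)) (allFin⁺ size)

  L-complete : ∀ c → c ∈ L
  L-complete c = subst (_∈ L) (Inverse.strictlyInverseˡ enum c) (∈-map⁺ (Inverse.to enum) (∈-allFin (Inverse.from enum c)))

  ∑-δ : ∀ c (f : Carrier → ℕ) → ∑[ x ∈ L ] (δ c x *ⁿ f x) ≡ f c
  ∑-δ c f = ∑-pick (δ c) f (δ-≡ refl) δ-≢ L-unique (L-complete c)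

  ∑-δ≡1 : ∀ c → ∑[ x ∈ L ] δ c x ≡ 1
  ∑-δ≡1 c = trans (∑-cong L (λ x → sym (ℕ.*-identityʳ (δ c x)))) (∑-δ c (λ _ → 1))

  term≤∑ : ∀ (f : Carrier → ℕ) c → f c ≤ⁿ ∑ L f
  term≤∑ f c = ℕ.≤-trans (ℕ.≤-reflexive (sym (∑-δ c f)))
    (∑-mono L (λ x → ℕ.≤-trans (ℕ.*-monoˡ-≤ (f x) (δ≤1 c x)) (ℕ.≤-reflexive (ℕ.*-identityˡ (f x)))))

  ∑-δ-translate : ∀ x c → ∑[ t ∈ L ] δ (x + t) c ≡ 1
  ∑-δ-translate x c = trans (∑-cong L (λ t → δ-cong (to t) (from t))) (∑-δ≡1 (- x + c))
    where
    to : ∀ t → x + t ≡ c → - x + c ≡ t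
    to t refl = trans (sym (+-assoc (- x) x t)) (trans (cong (_+ t) (-‿inverseˡ x)) (+-identityˡ t))
    from : ∀ t → - x + c ≡ t → x + t ≡ c
    from t refl = trans (sym (+-assoc x (- x) c)) (trans (cong (_+ c) (-‿inverseʳ x)) (+-identityˡ c))

  -- As x is invertible, l = (a - b) / x is the only solution. This serves both to recover a ratio l
  -- from x and x′ and to intersect lines.
  ∑-δ-affine : ∀ {x} → x ≢ 0# → ∀ a b → ∑[ l ∈ L ] δ a (l * x + b) ≡ 1
  ∑-δ-affine {x} x≢0 a b with l₀ , l₀x≡a-b ← division x≢0 (a + - b) =
    trans (∑-cong L (λ l → δ-cong (to l) (from l))) (∑-δ≡1 l₀)
    where
    a≡l₀x+b : a ≡ l₀ * x + b
    a≡l₀x+b = sym (begin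
      l₀ * x + b      ≡⟨ cong (_+ b) l₀x≡a-b ⟩
      a + - b + b     ≡⟨ +-assoc a (- b) b ⟩
      a + (- b + b)   ≡⟨ cong (a +_) (-‿inverseˡ b) ⟩
      a + 0#          ≡⟨ +-identityʳ a ⟩
      a               ∎)
      where open ≡-Reasoning
    to : ∀ l → a ≡ l * x + b → l₀ ≡ l
    to l e = *-cancelʳ x≢0 l₀ l (+-cancelʳ b (l₀ * x) (l * x) (trans (sym a≡l₀x+b) e))
    from : ∀ l → l₀ ≡ l → a ≡ l * x + b
    from l refl = a≡l₀x+b

  ==H⇒≡ : ∀ {g h} → _==H_ F g h ≡ true → g ≡ h
  ==H⇒≡ {x , y , z} {x′ , y′ , z′} e with x ≟ x′ | y ≟ y′ | z ≟ z′
  ... | yes refl | yes refl | yes refl = refl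

  δᴴ : Heis F → Heis F → ℕ
  δᴴ g h = 𝟙 (_==H_ F g h)

  ∑-heisElems : ∀ (f : Heis F → ℕ) → ∑ (heisElems F) f ≡ ∑[ x ∈ L ] ∑[ y ∈ L ] ∑[ z ∈ L ] f (x , y , z)
  ∑-heisElems f = trans (∑-concatMap L _ f) (∑-cong L (λ x →
    trans (∑-concatMap L _ f) (∑-cong L (λ y → ∑-map L _ f))))

  -- This is the `pick` hypothesis of `cauchy-schwarz-collisions` for the group; the coordinates are
  -- summed out one at a time by `∑-δ`.
  ∑-δᴴ : ∀ g (f : Heis F → ℕ) → ∑[ h ∈ heisElems F ] (δᴴ g h *ⁿ f h) ≡ f g
  ∑-δᴴ (x , y , z) f = begin
    ∑[ h ∈ heisElems F ] (δᴴ (x , y , z) h *ⁿ f h)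
      ≡⟨ ∑-heisElems _ ⟩
    ∑[ x′ ∈ L ] ∑[ y′ ∈ L ] ∑[ z′ ∈ L ] (δᴴ (x , y , z) (x′ , y′ , z′) *ⁿ f (x′ , y′ , z′))
      ≡⟨ ∑-cong L (λ x′ → trans (∑-cong L (λ y′ → trans (∑-cong L (λ z′ → split x′ y′ z′)) (∑-*ˡ L (δ x x′) _))) (∑-*ˡ L (δ x x′) _)) ⟩
    ∑[ x′ ∈ L ] (δ x x′ *ⁿ (∑[ y′ ∈ L ] ∑[ z′ ∈ L ] (δ y y′ *ⁿ (δ z z′ *ⁿ f (x′ , y′ , z′)))))
      ≡⟨ ∑-δ x _ ⟩
    ∑[ y′ ∈ L ] ∑[ z′ ∈ L ] (δ y y′ *ⁿ (δ z z′ *ⁿ f (x , y′ , z′)))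
      ≡⟨ ∑-cong L (λ y′ → ∑-*ˡ L (δ y y′) _) ⟩
    ∑[ y′ ∈ L ] (δ y y′ *ⁿ (∑[ z′ ∈ L ] (δ z z′ *ⁿ f (x , y′ , z′))))
      ≡⟨ ∑-δ y _ ⟩
    ∑[ z′ ∈ L ] (δ z z′ *ⁿ f (x , y , z′))
      ≡⟨ ∑-δ z _ ⟩
    f (x , y , z) ∎
    where
    open ≡-Reasoning
    regroup : ∀ a b c d → a *ⁿ (b *ⁿ c) *ⁿ d ≡ a *ⁿ (b *ⁿ (c *ⁿ d))
    regroup = solve-∀
    split : ∀ x′ y′ z′ → δᴴ (x , y , z) (x′ , y′ , z′) *ⁿ f (x′ , y′ , z′) ≡ δ x x′ *ⁿ (δ y y′ *ⁿ (δ z z′ *ⁿ f (x′ , y′ , z′)))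
    split x′ y′ z′ = trans
      (cong (_*ⁿ f (x′ , y′ , z′)) (trans (𝟙-∧ (_==_ F x x′) _) (cong (δ x x′ *ⁿ_) (𝟙-∧ (_==_ F y y′) _))))
      (regroup (δ x x′) (δ y y′) (δ z z′) (f (x′ , y′ , z′)))

  card≡∑ : ∀ A → card F A ≡ ∑[ x ∈ L ] 𝟙 (A x)
  card≡∑ A = length-filter≡∑𝟙 A L

  countH≡∑ : ∀ P → countH F P ≡ ∑[ g ∈ heisElems F ] 𝟙 (P g)
  countH≡∑ P = length-filter≡∑𝟙 P (heisElems F)

  addEnergy≡∑ : ∀ A → addEnergy F A ≡
    ∑[ a ∈ L ] ∑[ b ∈ L ] ∑[ c ∈ L ] ∑[ d ∈ L ] 𝟙 (A a ∧ A b ∧ A c ∧ A d ∧ _==_ F (a + b) (c + d))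
  addEnergy≡∑ A = trans (length-filter≡∑𝟙 (λ t → t) (concatMap quads₁ L))
    (trans (∑-concatMap L quads₁ 𝟙) (∑-cong L (λ a →
     trans (∑-concatMap L (quads₂ a) 𝟙) (∑-cong L (λ b →
     trans (∑-concatMap L (quads₃ a b) 𝟙) (∑-cong L (λ c → ∑-map L (quad a b c) 𝟙)))))))
    where
    quad : Carrier → Carrier → Carrier → Carrier → Bool
    quad a b c d = A a ∧ A b ∧ A c ∧ A d ∧ _==_ F (a + b) (c + d)
    quads₃ : Carrier → Carrier → Carrier → List Bool
    quads₃ a b c = map (quad a b c) L
    quads₂ : Carrier → Carrier → List Bool
    quads₂ a b = concatMap (quads₃ a b) L
    quads₁ : Carrier → List Bool
    quads₁ a = concatMap (quads₂ a) L

  -- The coordinate z is forced to be `0#`, so its sum contributes a factor 1. This turns |[A,A,0]|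
  -- in the conclusion into |A|².
  cardAA0≡card² : ∀ A → cardAA0 F A ≡ card F A *ⁿ card F A
  cardAA0≡card² A = begin
    cardAA0 F A
      ≡⟨ trans (countH≡∑ (inAA0 F A)) (∑-heisElems _) ⟩
    ∑[ x ∈ L ] ∑[ y ∈ L ] ∑[ z ∈ L ] 𝟙 (A x ∧ A y ∧ _==_ F z 0#)
      ≡⟨ ∑-cong L (λ x → ∑-cong L (λ y → trans (∑-cong L (λ z → split x y z))
           (trans (∑-*ˡ L (𝟙 (A x) *ⁿ 𝟙 (A y)) _)
           (trans (cong (𝟙 (A x) *ⁿ 𝟙 (A y) *ⁿ_) (∑-δ≡1 0#)) (ℕ.*-identityʳ _))))) ⟩
    ∑[ x ∈ L ] ∑[ y ∈ L ] (𝟙 (A x) *ⁿ 𝟙 (A y))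
      ≡⟨ ∑-*∑ L L _ _ ⟩
    (∑[ x ∈ L ] 𝟙 (A x)) *ⁿ (∑[ y ∈ L ] 𝟙 (A y))
      ≡⟨ cong₂ _*ⁿ_ (card≡∑ A) (card≡∑ A) ⟨
    card F A *ⁿ card F A ∎
    where
    open ≡-Reasoning
    split : ∀ x y z → 𝟙 (A x ∧ A y ∧ _==_ F z 0#) ≡ 𝟙 (A x) *ⁿ 𝟙 (A y) *ⁿ δ 0# z
    split x y z = trans (𝟙-∧ (A x) _) (trans (cong (𝟙 (A x) *ⁿ_) (trans (𝟙-∧ (A y) _)
      (cong (𝟙 (A y) *ⁿ_) (δ-cong {z} {0#} {0#} {z} sym sym)))) (sym (ℕ.*-assoc (𝟙 (A x)) _ _)))

-- Collisions and the size of the product set.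

-- Products [x, b, 0][a, y, 0] are counted with x, y ∈ B and a, b ∈ A.
module Products (F : FiniteField) (A B : FiniteField.Carrier F → Bool) (B⇒A : ∀ x → B x ≡ true → A x ≡ true) where
  open FieldSums F public

  L² : List (Carrier × Carrier)
  L² = cartesianProduct L L

  α β : Carrier → ℕ
  α x = 𝟙 (A x)
  β x = 𝟙 (B x)

  n m : ℕ
  n = ∑ L α
  m = ∑ L β

  w : Carrier × Carrier → ℕ
  w (x , a) = β x *ⁿ α a

  W : ℕ
  W = ∑ L² w

  W≡m*n : W ≡ m *ⁿ n
  W≡m*n = trans (∑-cartesianProduct L L w) (∑-*∑ L L β α)

  L⁴ : List ((Carrier × Carrier) × (Carrier × Carrier))
  L⁴ = cartesianProduct L² L²

  V : (Carrier × Carrier) × (Carrier × Carrier) → ℕ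
  V (p , r) = w p *ⁿ w r

  -- The value is (x + a, b + y, x y) up to zero summands. Grouping x with a and y with b makes each
  -- of the first two coordinates depend on one pair only.
  φ : (Carrier × Carrier) × (Carrier × Carrier) → Heis F
  φ ((x , a) , (y , b)) = hmul F (x , b , 0#) (a , y , 0#)

  collisions : ℕ
  collisions = ∑[ i ∈ L⁴ ] ∑[ j ∈ L⁴ ] (V i *ⁿ V j *ⁿ δᴴ (φ j) (φ i))

  ==H-refl : ∀ g → _==H_ F g g ≡ true
  ==H-refl (x , y , z) with x ≟ x | y ≟ y | z ≟ z
  ... | yes _ | yes _ | yes _ = refl
  ... | no ¬p | _     | _     = contradiction refl ¬p
  ... | yes _ | no ¬p | _     = contradiction refl ¬p
  ... | yes _ | yes _ | no ¬p = contradiction refl ¬p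

  -- Existence by counting: the term h = g, isolated by `∑-δᴴ`, already contributes 1 to the number
  -- of elements satisfying p.
  any-heisElems : ∀ (p : Heis F → Bool) g → p g ≡ true → any p (heisElems F) ≡ true
  any-heisElems p g pg = ∑𝟙⇒any p (heisElems F) (begin
    1                                               ≡⟨ cong 𝟙 pg ⟨
    𝟙 (p g)                                         ≡⟨ ∑-δᴴ g (λ h → 𝟙 (p h)) ⟨
    ∑[ h ∈ heisElems F ] (δᴴ g h *ⁿ 𝟙 (p h))        ≤⟨ ∑-mono (heisElems F) (λ h → ℕ.*-monoˡ-≤ (𝟙 (p h)) (𝟙≤1 (_==H_ F g h))) ⟩
    ∑[ h ∈ heisElems F ] (1 *ⁿ 𝟙 (p h))             ≡⟨ ∑-cong (heisElems F) (λ h → ℕ.*-identityˡ _) ⟩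
    ∑[ h ∈ heisElems F ] 𝟙 (p h)                    ∎)
    where open ℕ.≤-Reasoning

  ∈inAA0 : ∀ {x y} → A x ≡ true → A y ≡ true → inAA0 F A (x , y , 0#) ≡ true
  ∈inAA0 {x} {y} Ax Ay rewrite Ax | Ay with 0# ≟ 0#
  ... | yes _   = refl
  ... | no  0≢0 = contradiction refl 0≢0

  ∈inProd : ∀ {g h} → inAA0 F A g ≡ true → inAA0 F A h ≡ true → inProd F A (hmul F g h) ≡ true
  ∈inProd {g} {h} Ag Ah = any-heisElems _ g (any-heisElems _ h found)
    where
    found : inAA0 F A g ∧ inAA0 F A h ∧ _==H_ F (hmul F g h) (hmul F g h) ≡ true
    found rewrite Ag | Ah = ==H-refl (hmul F g h)

  support : ∀ p → 1 ≤ⁿ w p → A (proj₁ p) ≡ true × A (proj₂ p) ≡ true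
  support (x , a) h = B⇒A x (1≤𝟙⇒true (1≤m*n⇒1≤m (β x) (α a) h)) , 1≤𝟙⇒true (1≤m*n⇒1≤n (β x) (α a) h)

  V⇒inProd : ∀ i → 1 ≤ⁿ V i → 1 ≤ⁿ 𝟙 (inProd F A (φ i))
  V⇒inProd (p , r) h
    with Ax , Aa ← support p (1≤m*n⇒1≤m (w p) (w r) h)
       | Ay , Ab ← support r (1≤m*n⇒1≤n (w p) (w r) h)
    = ℕ.≤-reflexive (cong 𝟙 (sym (∈inProd (∈inAA0 Ax Ab) (∈inAA0 Aa Ay))))

  -- This is `cauchy-schwarz-collisions` with P the indicator of the product set: the quadruples
  -- have total weight W², and those of positive weight are sent into that set.
  W⁴≤cardProd*collisions : W *ⁿ W *ⁿ (W *ⁿ W) ≤ⁿ cardProd F A *ⁿ collisions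
  W⁴≤cardProd*collisions = begin
    W *ⁿ W *ⁿ (W *ⁿ W)
      ≡⟨ cong₂ _*ⁿ_ ∑V ∑V ⟨
    ∑ L⁴ V *ⁿ ∑ L⁴ V
      ≤⟨ cauchy-schwarz-collisions L⁴ (heisElems F) δᴴ ∑-δᴴ V φ (λ g → 𝟙 (inProd F A g)) (λ g → 𝟙≤1 (inProd F A g)) V⇒inProd ⟩
    (∑[ g ∈ heisElems F ] 𝟙 (inProd F A g)) *ⁿ collisions
      ≡⟨ cong (_*ⁿ collisions) (countH≡∑ (inProd F A)) ⟨
    cardProd F A *ⁿ collisions ∎
    where
    open ℕ.≤-Reasoning
    ∑V : ∑ L⁴ V ≡ W *ⁿ W
    ∑V = trans (∑-cartesianProduct L² L² V) (∑-*∑ L² L² w w)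

-- Sorting collisions by their ratio.

module NonzeroProducts (F : FiniteField) (A B : FiniteField.Carrier F → Bool)
  (B⇒A : ∀ x → B x ≡ true → A x ≡ true) (B⇒≢0 : ∀ x → B x ≡ true → x ≢ FiniteField.0# F) where
  open Products F A B B⇒A public

  -- One kernel serves both halves of a collision: x′ = l x for (p, p′), and y = l y′ for the
  -- reversed pair (r′, r).
  T : Carrier → Carrier × Carrier → Carrier × Carrier → ℕ
  T l p@(x , a) p′@(x′ , a′) = w p *ⁿ w p′ *ⁿ (δ (x + a) (x′ + a′) *ⁿ δ (l * x) x′)

  H : Carrier → ℕ
  H l = ∑[ p ∈ L² ] ∑[ p′ ∈ L² ] T l p p′

  w⇒≢0 : ∀ x a → 1 ≤ⁿ w (x , a) → x ≢ 0#
  w⇒≢0 x a h = B⇒≢0 x (1≤𝟙⇒true (1≤m*n⇒1≤m (β x) (α a) h))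

  -- Take l = x′ / x. Then l y′ x = l x y′ = x′ y′ = x y, and x cancels.
  common-ratio : ∀ {x} → x ≢ 0# → ∀ y x′ y′ → x * y ≡ x′ * y′ → Σ Carrier (λ l → l * x ≡ x′ × l * y′ ≡ y)
  common-ratio {x} x≢0 y x′ y′ e with l , refl ← division x≢0 x′ =
    l , refl , *-cancelʳ x≢0 (l * y′) y (begin
      l * y′ * x     ≡⟨ *-assoc l y′ x ⟩
      l * (y′ * x)   ≡⟨ cong (l *_) (*-comm y′ x) ⟩
      l * (x * y′)   ≡⟨ *-assoc l x y′ ⟨
      l * x * y′     ≡⟨ e ⟨
      x * y          ≡⟨ *-comm x y ⟩
      y * x          ∎)
    where open ≡-Reasoning

  -- A collision supplies a ratio l at which the product of the two kernels equals the full weight,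
  -- so this single term of the sum suffices.
  collision≤ : ∀ p r p′ r′ → V (p , r) *ⁿ V (p′ , r′) *ⁿ δᴴ (φ (p′ , r′)) (φ (p , r)) ≤ⁿ ∑[ l ∈ L ] (T l p p′ *ⁿ T l r′ r)
  collision≤ p@(x , a) r@(y , b) p′@(x′ , a′) r′@(y′ , b′) = begin
    -- A positive c gives p positive weight, so x is nonzero and `common-ratio` applies.
    c *ⁿ δᴴ (φ (p′ , r′)) (φ (p , r))   ≤⟨ *-monoʳ-≤-if c (λ 1≤c → 𝟙≤ (λ same → ratio 1≤c (==H⇒≡ same))) ⟩
    c *ⁿ ∑ L e                          ≡⟨ ∑-*ˡ L c e ⟨
    ∑[ l ∈ L ] (c *ⁿ e l)               ≡⟨ ∑-cong L (λ l → regroup (w p) (w r) (w p′) (w r′) (δ (x + a) (x′ + a′) *ⁿ δ (l * x) x′) (δ (y′ + b′) (y + b) *ⁿ δ (l * y′) y)) ⟩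
    ∑[ l ∈ L ] (T l p p′ *ⁿ T l r′ r)   ∎
    where
    open ℕ.≤-Reasoning
    c = V (p , r) *ⁿ V (p′ , r′)
    e : Carrier → ℕ
    e l = δ (x + a) (x′ + a′) *ⁿ δ (l * x) x′ *ⁿ (δ (y′ + b′) (y + b) *ⁿ δ (l * y′) y)
    regroup : ∀ wp wr wp′ wr′ s t → wp *ⁿ wr *ⁿ (wp′ *ⁿ wr′) *ⁿ (s *ⁿ t) ≡ wp *ⁿ wp′ *ⁿ s *ⁿ (wr′ *ⁿ wr *ⁿ t)
    regroup = solve-∀
    𝟙≤ : ∀ {t k} → (t ≡ true → 1 ≤ⁿ k) → 𝟙 t ≤ⁿ k
    𝟙≤ {true}  h = h refl
    𝟙≤ {false} h = z≤n
    0+0+ : ∀ z → 0# + 0# + z ≡ z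
    0+0+ z = trans (cong (_+ z) (+-identityˡ 0#)) (+-identityˡ z)
    ratio : 1 ≤ⁿ c → φ (p′ , r′) ≡ φ (p , r) → 1 ≤ⁿ ∑ L e
    ratio 1≤c same
      with l , lx≡x′ , ly′≡y ← common-ratio (w⇒≢0 x a (1≤m*n⇒1≤m (w p) (w r) (1≤m*n⇒1≤m (V (p , r)) (V (p′ , r′)) 1≤c))) y x′ y′
             (trans (sym (0+0+ (x * y))) (trans (sym (cong (λ g → proj₂ (proj₂ g)) same)) (0+0+ (x′ * y′))))
      = ℕ.≤-trans (ℕ.≤-reflexive (sym eₗ)) (term≤∑ e l)
      where
      -- The second coordinates are b + y and b′ + y′, whereas `T` adds in the order y + b; hence
      -- the uses of `+-comm`.
      eₗ : e l ≡ 1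
      eₗ rewrite δ-≡ (cong proj₁ (sym same)) | δ-≡ lx≡x′
        | δ-≡ (trans (+-comm y′ b′) (trans (cong (λ g → proj₁ (proj₂ g)) same) (+-comm b y))) | δ-≡ ly′≡y = refl

  collisions≤∑H² : collisions ≤ⁿ ∑[ l ∈ L ] (H l *ⁿ H l)
  collisions≤∑H² = begin
    collisions
      ≡⟨ trans (∑-cartesianProduct L² L² _) (∑-cong L² (λ p → ∑-cong L² (λ r → ∑-cartesianProduct L² L² _))) ⟩
    ∑[ p ∈ L² ] ∑[ r ∈ L² ] ∑[ p′ ∈ L² ] ∑[ r′ ∈ L² ] (V (p , r) *ⁿ V (p′ , r′) *ⁿ δᴴ (φ (p′ , r′)) (φ (p , r)))
      ≤⟨ ∑-mono L² (λ p → ∑-mono L² (λ r → ∑-mono L² (λ p′ → ∑-mono L² (λ r′ → collision≤ p r p′ r′)))) ⟩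
    ∑[ p ∈ L² ] ∑[ r ∈ L² ] ∑[ p′ ∈ L² ] ∑[ r′ ∈ L² ] ∑[ l ∈ L ] (T l p p′ *ⁿ T l r′ r)
      ≡⟨ ∑-cong L² (λ p → ∑-cong L² (λ r → trans (∑-cong L² (λ p′ → ∑-swap L² L _)) (∑-swap L² L _))) ⟩
    ∑[ p ∈ L² ] ∑[ r ∈ L² ] ∑[ l ∈ L ] ∑[ p′ ∈ L² ] ∑[ r′ ∈ L² ] (T l p p′ *ⁿ T l r′ r)
      ≡⟨ trans (∑-cong L² (λ p → ∑-swap L² L _)) (∑-swap L² L _) ⟩
    ∑[ l ∈ L ] ∑[ p ∈ L² ] ∑[ r ∈ L² ] ∑[ p′ ∈ L² ] ∑[ r′ ∈ L² ] (T l p p′ *ⁿ T l r′ r)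
      -- For fixed l the summand is a function of (p, p′) times a function of (r, r′), so the sum
      -- factors.
      ≡⟨ ∑-cong L (λ l → trans (∑-cong L² (λ p → ∑-cong L² (λ r → ∑-*∑ L² L² (T l p) (λ r′ → T l r′ r))))
                               (∑-*∑ L² L² (λ p → ∑ L² (T l p)) (λ r → ∑[ r′ ∈ L² ] T l r′ r))) ⟩
    ∑[ l ∈ L ] (H l *ⁿ (∑[ r ∈ L² ] ∑[ r′ ∈ L² ] T l r′ r))
      ≡⟨ ∑-cong L (λ l → cong (H l *ⁿ_) (∑-swap L² L² (λ r r′ → T l r′ r))) ⟩
    ∑[ l ∈ L ] (H l *ⁿ H l) ∎
    where open ℕ.≤-Reasoning

  β≤α : ∀ x → β x ≤ⁿ α x
  β≤α x with B x in Bx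
  ... | true  = ℕ.≤-reflexive (cong 𝟙 (sym (B⇒A x Bx)))
  ... | false = z≤n

  -- A solution of x + a = x′ + a′ is counted once for each l with l x = x′, and x ≠ 0 on B allows
  -- exactly one. So the sum counts additive quadruples with x, x′ ∈ B, which are among those of A.
  ∑H≤addEnergy : ∑ L H ≤ⁿ addEnergy F A
  ∑H≤addEnergy = begin
    ∑ L H
      ≡⟨ trans (∑-swap L L² _) (∑-cong L² (λ p → ∑-swap L L² _)) ⟩
    ∑[ p ∈ L² ] ∑[ p′ ∈ L² ] ∑[ l ∈ L ] T l p p′
      ≤⟨ ∑-mono L² (λ p → ∑-mono L² (λ p′ → bound p p′)) ⟩
    ∑[ p ∈ L² ] ∑[ p′ ∈ L² ] quad p p′
      ≡⟨ trans (∑-cartesianProduct L L _) (∑-cong L (λ a → ∑-cong L (λ b → ∑-cartesianProduct L L _))) ⟩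
    ∑[ a ∈ L ] ∑[ b ∈ L ] ∑[ c ∈ L ] ∑[ d ∈ L ] quad (a , b) (c , d)
      ≡⟨ addEnergy≡∑ A ⟨
    addEnergy F A ∎
    where
    open ℕ.≤-Reasoning
    quad : Carrier × Carrier → Carrier × Carrier → ℕ
    quad (a , b) (c , d) = 𝟙 (A a ∧ A b ∧ A c ∧ A d ∧ _==_ F (a + b) (c + d))
    quad≡ : ∀ a b c d → quad (a , b) (c , d) ≡ α a *ⁿ α b *ⁿ (α c *ⁿ α d) *ⁿ δ (a + b) (c + d)
    quad≡ a b c d with A a | A b | A c | A d
    ... | true  | true  | true  | true  = sym (ℕ.*-identityˡ _)
    ... | true  | true  | true  | false = refl
    ... | true  | true  | false | _     = refl
    ... | true  | false | _     | _     = refl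
    ... | false | _     | _     | _     = refl
    bound : ∀ p p′ → ∑[ l ∈ L ] T l p p′ ≤ⁿ quad p p′
    bound p@(x , a) p′@(x′ , a′) = begin
      ∑[ l ∈ L ] T l p p′
        ≡⟨ trans (∑-*ˡ L (w p *ⁿ w p′) _) (trans (cong (w p *ⁿ w p′ *ⁿ_) (∑-*ˡ L s _)) (regroup (w p) (w p′) s _)) ⟩
      w p *ⁿ (w p′ *ⁿ s *ⁿ (∑[ l ∈ L ] δ (l * x) x′))
        ≤⟨ *-monoʳ-≤-if (w p) (λ 1≤w → ℕ.≤-reflexive (cong (w p′ *ⁿ s *ⁿ_) (one 1≤w))) ⟩
      w p *ⁿ (w p′ *ⁿ s *ⁿ 1)
        ≡⟨ drop (w p) (w p′) s ⟩
      w p *ⁿ w p′ *ⁿ s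
        ≤⟨ ℕ.*-monoˡ-≤ s (ℕ.*-mono-≤ (ℕ.*-monoˡ-≤ (α a) (β≤α x)) (ℕ.*-monoˡ-≤ (α a′) (β≤α x′))) ⟩
      α x *ⁿ α a *ⁿ (α x′ *ⁿ α a′) *ⁿ s
        ≡⟨ quad≡ x a x′ a′ ⟨
      quad p p′ ∎
      where
      s = δ (x + a) (x′ + a′)
      regroup : ∀ u v s t → u *ⁿ v *ⁿ (s *ⁿ t) ≡ u *ⁿ (v *ⁿ s *ⁿ t)
      regroup = solve-∀
      drop : ∀ u v s → u *ⁿ (v *ⁿ s *ⁿ 1) ≡ u *ⁿ v *ⁿ s
      drop = solve-∀
      one : 1 ≤ⁿ w p → ∑[ l ∈ L ] δ (l * x) x′ ≡ 1
      one 1≤w = trans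
        (∑-cong L (λ l → δ-cong (λ e → sym (trans (+-identityʳ (l * x)) e)) (λ e → sym (trans e (+-identityʳ (l * x))))))
        (∑-δ-affine (w⇒≢0 x a 1≤w) x′ 0#)

  -- Incidences between points and lines.

  -- In the (l, t)-plane a pair (x, b) ∈ B × A stands for the line t = l x + b - x, written without
  -- subtraction; u l t is the number of these lines through (l, t).
  u : Carrier → Carrier → ℕ
  u l t = ∑[ p ∈ L² ] (w p *ⁿ δ (proj₁ p + t) (l * proj₁ p + proj₂ p))

  H′ : Carrier → ℕ
  H′ l = ∑[ t ∈ L ] (α t *ⁿ u l t)

  -- Dropping the factor β x′ ≤ 1 frees x′ from B, and summing over x′ then substitutes l x for it.
  H≤H′ : ∀ l → H l ≤ⁿ H′ l
  H≤H′ l = begin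
    H l
      ≡⟨ trans (∑-cartesianProduct L L _) (∑-cong L (λ x → ∑-cong L (λ a → ∑-cartesianProduct L L _))) ⟩
    ∑[ x ∈ L ] ∑[ a ∈ L ] ∑[ x′ ∈ L ] ∑[ b ∈ L ] T l (x , a) (x′ , b)
      ≤⟨ ∑-mono L (λ x → ∑-mono L (λ a → ∑-mono L (λ x′ → ∑-mono L (λ b → forget x a x′ b)))) ⟩
    ∑[ x ∈ L ] ∑[ a ∈ L ] ∑[ x′ ∈ L ] ∑[ b ∈ L ] (δ (l * x) x′ *ⁿ (α a *ⁿ (w (x , b) *ⁿ δ (x + a) (x′ + b))))
      ≡⟨ ∑-cong L (λ x → ∑-cong L (λ a → trans (∑-cong L (λ x′ → ∑-*ˡ L (δ (l * x) x′) _)) (∑-δ (l * x) _))) ⟩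
    ∑[ x ∈ L ] ∑[ a ∈ L ] ∑[ b ∈ L ] (α a *ⁿ (w (x , b) *ⁿ δ (x + a) (l * x + b)))
      ≡⟨ ∑-swap L L _ ⟩
    ∑[ a ∈ L ] ∑[ x ∈ L ] ∑[ b ∈ L ] (α a *ⁿ (w (x , b) *ⁿ δ (x + a) (l * x + b)))
      ≡⟨ ∑-cong L (λ a → trans (sym (∑-cartesianProduct L L _)) (∑-*ˡ L² (α a) _)) ⟩
    H′ l ∎
    where
    open ℕ.≤-Reasoning
    forget : ∀ x a x′ b → T l (x , a) (x′ , b) ≤ⁿ δ (l * x) x′ *ⁿ (α a *ⁿ (w (x , b) *ⁿ δ (x + a) (x′ + b)))
    forget x a x′ b = begin
      T l (x , a) (x′ , b)
        ≡⟨ out (β x) (α a) (β x′) (α b) (δ (x + a) (x′ + b)) (δ (l * x) x′) ⟩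
      β x′ *ⁿ (δ (l * x) x′ *ⁿ (α a *ⁿ (w (x , b) *ⁿ δ (x + a) (x′ + b))))
        ≤⟨ ℕ.*-monoˡ-≤ _ (𝟙≤1 (B x′)) ⟩
      1 *ⁿ (δ (l * x) x′ *ⁿ (α a *ⁿ (w (x , b) *ⁿ δ (x + a) (x′ + b))))
        ≡⟨ ℕ.*-identityˡ _ ⟩
      δ (l * x) x′ *ⁿ (α a *ⁿ (w (x , b) *ⁿ δ (x + a) (x′ + b))) ∎
      where
      out : ∀ bx aa bx′ ab s t → bx *ⁿ aa *ⁿ (bx′ *ⁿ ab) *ⁿ (s *ⁿ t) ≡ bx′ *ⁿ (t *ⁿ (aa *ⁿ (bx *ⁿ ab *ⁿ s)))
      out = solve-∀

  -- At each height t the line of (x, b) has exactly one l, because x ≠ 0. Hence H′ has mean n W /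
  -- q.
  ∑H′ : ∑ L H′ ≡ n *ⁿ W
  ∑H′ = begin
    ∑ L H′                                        ≡⟨ trans (∑-swap L L _) (∑-cong L (λ t → ∑-*ˡ L (α t) _)) ⟩
    ∑[ t ∈ L ] (α t *ⁿ (∑[ l ∈ L ] u l t))        ≡⟨ ∑-cong L (λ t → cong (α t *ⁿ_) (∑u t)) ⟩
    ∑[ t ∈ L ] (α t *ⁿ W)                         ≡⟨ ∑-*ʳ L W α ⟩
    n *ⁿ W                                        ∎
    where
    open ≡-Reasoning
    ∑u : ∀ t → ∑[ l ∈ L ] u l t ≡ W
    ∑u t = begin
      ∑[ l ∈ L ] u l t
        ≡⟨ trans (∑-swap L L² _) (∑-cong L² (λ p → ∑-*ˡ L (w p) _)) ⟩
      ∑[ p ∈ L² ] (w p *ⁿ (∑[ l ∈ L ] δ (proj₁ p + t) (l * proj₁ p + proj₂ p)))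
        ≡⟨ ∑-cong L² one ⟩
      W ∎
      where
      one : ∀ p → w p *ⁿ (∑[ l ∈ L ] δ (proj₁ p + t) (l * proj₁ p + proj₂ p)) ≡ w p
      -- A zero weight settles the claim; a positive one supplies the x ≢ `0#` that `∑-δ-affine`
      -- requires.
      one p@(x , b) with w p | w⇒≢0 x b
      ... | zero  | _   = refl
      ... | suc k | x≢0 = trans (cong (suc k *ⁿ_) (∑-δ-affine (x≢0 (s≤s z≤n)) (x + t) b)) (ℕ.*-identityʳ (suc k))

  -- Each of the W lines has one point over every l, hence q points; so u has mean W / q over the q²
  -- points of the plane.
  ∑∑u : ∑[ l ∈ L ] ∑[ t ∈ L ] u l t ≡ size *ⁿ W
  ∑∑u = trans (∑-cong L (λ l → trans (∑-swap L L² _) (∑-cong L² (λ p →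
      trans (∑-*ˡ L (w p) _) (trans (cong (w p *ⁿ_) (∑-δ-translate (proj₁ p) _)) (ℕ.*-identityʳ (w p)))))))
    (trans (∑-const L W) (cong (_*ⁿ W) length-L))

  -- The lines s = l x + b − x attached to (x, b) and (x′, b′) meet in at most one point (l, s),
  -- unless they coincide, since they are disjoint when x = x′ and b ≠ b′.
  ∑-two-lines : ∀ x b x′ b′
    → ∑[ l ∈ L ] ∑[ t ∈ L ] (δ (x + t) (l * x + b) *ⁿ δ (x′ + t) (l * x′ + b′)) ≤ⁿ δ x x′ *ⁿ (δ b b′ *ⁿ size) +ⁿ 1
  ∑-two-lines x b x′ b′ with x ≟ x′
  ... | yes refl = begin
    ∑[ l ∈ L ] ∑[ t ∈ L ] (δ (x + t) (l * x + b) *ⁿ δ (x + t) (l * x + b′))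
      ≤⟨ ∑-mono L (λ l → ∑-mono L (λ t → parallel l t)) ⟩
    ∑[ l ∈ L ] ∑[ t ∈ L ] (δ (x + t) (l * x + b) *ⁿ δ b b′)
      ≡⟨ ∑-cong L (λ l → trans (∑-*ʳ L (δ b b′) _) (trans (cong (_*ⁿ δ b b′) (∑-δ-translate x _)) (ℕ.*-identityˡ _))) ⟩
    ∑[ l ∈ L ] δ b b′
      ≡⟨ trans (∑-const L (δ b b′)) (trans (cong (_*ⁿ δ b b′) length-L) (ℕ.*-comm size (δ b b′))) ⟩
    δ b b′ *ⁿ size
      ≤⟨ ℕ.m≤m+n _ 1 ⟩
    δ b b′ *ⁿ size +ⁿ 1
      ≡⟨ cong (_+ⁿ 1) (ℕ.*-identityˡ (δ b b′ *ⁿ size)) ⟨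
    1 *ⁿ (δ b b′ *ⁿ size) +ⁿ 1 ∎
    where
    open ℕ.≤-Reasoning
    parallel : ∀ l t → δ (x + t) (l * x + b) *ⁿ δ (x + t) (l * x + b′) ≤ⁿ δ (x + t) (l * x + b) *ⁿ δ b b′
    parallel l t = *-monoʳ-≤-if (δ (x + t) (l * x + b)) (λ on → δ≤ (λ on′ →
      ℕ.≤-reflexive (sym (δ-≡ (+-cancelˡ (l * x) b b′ (trans (sym (==⇒≡ (1≤𝟙⇒true on))) on′))))))
  -- Put d = x - x′. Subtracting the two equations removes t and leaves l d + b = b′ + d, with one
  -- solution l since d ≠ 0; the first line then determines t.
  ... | no x≢x′ = begin
    ∑[ l ∈ L ] ∑[ t ∈ L ] (δ (x + t) (l * x + b) *ⁿ δ (x′ + t) (l * x′ + b′))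
      ≤⟨ ∑-mono L (λ l → ∑-mono L (λ t → crossing l t)) ⟩
    ∑[ l ∈ L ] ∑[ t ∈ L ] (δ (x + t) (l * x + b) *ⁿ δ (b′ + d) (l * d + b))
      ≡⟨ ∑-cong L (λ l → trans (∑-*ʳ L (δ (b′ + d) (l * d + b)) _) (trans (cong (_*ⁿ δ (b′ + d) (l * d + b)) (∑-δ-translate x _)) (ℕ.*-identityˡ _))) ⟩
    ∑[ l ∈ L ] δ (b′ + d) (l * d + b)
      ≡⟨ ∑-δ-affine d≢0 (b′ + d) b ⟩
    1 ∎
    where
    open ℕ.≤-Reasoning
    d : Carrier
    d = - x′ + x
    x≡x′+d : x ≡ x′ + d
    x≡x′+d = trans (sym (+-identityˡ x)) (trans (cong (_+ x) (sym (-‿inverseʳ x′))) (+-assoc x′ (- x′) x))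
    d≢0 : d ≢ 0#
    d≢0 d≡0 = x≢x′ (trans x≡x′+d (trans (cong (x′ +_) d≡0) (+-identityʳ x′)))
    subtract : ∀ l t → x + t ≡ l * x + b → x′ + t ≡ l * x′ + b′ → b′ + d ≡ l * d + b
    subtract l t on on′ = +-cancelˡ (l * x′) (b′ + d) (l * d + b) (≡R.begin
      l * x′ + (b′ + d)     ≡R.≡⟨ +-assoc (l * x′) b′ d ⟨
      l * x′ + b′ + d       ≡R.≡⟨ cong (_+ d) on′ ⟨
      x′ + t + d            ≡R.≡⟨ trans (+-assoc x′ t d) (trans (cong (x′ +_) (+-comm t d)) (sym (+-assoc x′ d t))) ⟩
      x′ + d + t            ≡R.≡⟨ cong (_+ t) x≡x′+d ⟨
      x + t                 ≡R.≡⟨ on ⟩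
      l * x + b             ≡R.≡⟨ cong (λ c → l * c + b) x≡x′+d ⟩
      l * (x′ + d) + b      ≡R.≡⟨ cong (_+ b) (distribˡ l x′ d) ⟩
      l * x′ + l * d + b    ≡R.≡⟨ +-assoc (l * x′) (l * d) b ⟩
      l * x′ + (l * d + b)  ≡R.∎)
      where module ≡R = ≡-Reasoning
    crossing : ∀ l t → δ (x + t) (l * x + b) *ⁿ δ (x′ + t) (l * x′ + b′) ≤ⁿ δ (x + t) (l * x + b) *ⁿ δ (b′ + d) (l * d + b)
    crossing l t = *-monoʳ-≤-if (δ (x + t) (l * x + b)) (λ on → δ≤ (λ on′ →
      ℕ.≤-reflexive (sym (δ-≡ (subtract l t (==⇒≡ (1≤𝟙⇒true on)) on′)))))

  w≤1 : ∀ p → w p ≤ⁿ 1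
  w≤1 (x , b) = ℕ.*-mono-≤ (𝟙≤1 (B x)) (𝟙≤1 (A b))

  -- The squares expand into common points of pairs of lines. By `∑-two-lines` every one of the W²
  -- pairs is charged 1, and the W pairs of a line with itself are charged q more.
  ∑∑u² : ∑[ l ∈ L ] ∑[ t ∈ L ] (u l t *ⁿ u l t) ≤ⁿ size *ⁿ W +ⁿ W *ⁿ W
  ∑∑u² = begin
    ∑[ l ∈ L ] ∑[ t ∈ L ] (u l t *ⁿ u l t)
      ≡⟨ ∑-cong L (λ l → trans (∑-cong L (λ t → sym (∑-*∑ L² L² _ _))) (trans (∑-swap L L² _) (∑-cong L² (λ p → ∑-swap L L² _)))) ⟩
    ∑[ l ∈ L ] ∑[ p ∈ L² ] ∑[ p′ ∈ L² ] ∑[ t ∈ L ] (w p *ⁿ on l t p *ⁿ (w p′ *ⁿ on l t p′))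
      ≡⟨ trans (∑-swap L L² _) (∑-cong L² (λ p → ∑-swap L L² _)) ⟩
    ∑[ p ∈ L² ] ∑[ p′ ∈ L² ] ∑[ l ∈ L ] ∑[ t ∈ L ] (w p *ⁿ on l t p *ⁿ (w p′ *ⁿ on l t p′))
      ≡⟨ ∑-cong L² (λ p → ∑-cong L² (λ p′ → trans
           (∑-cong L (λ l → trans (∑-cong L (λ t → regroup (w p) _ (w p′) _)) (∑-*ˡ L (w p *ⁿ w p′) _)))
           (∑-*ˡ L (w p *ⁿ w p′) _))) ⟩
    ∑[ p ∈ L² ] ∑[ p′ ∈ L² ] (w p *ⁿ w p′ *ⁿ (∑[ l ∈ L ] ∑[ t ∈ L ] (on l t p *ⁿ on l t p′)))
      ≤⟨ ∑-mono L² (λ p → ∑-mono L² (λ p′ → pair≤ p p′)) ⟩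
    ∑[ p ∈ L² ] ∑[ p′ ∈ L² ] (w p *ⁿ (same p p′ *ⁿ size) +ⁿ w p *ⁿ w p′)
      ≡⟨ trans (∑-cong L² (λ p → ∑-+ L² _ _)) (∑-+ L² _ _) ⟩
    (∑[ p ∈ L² ] ∑[ p′ ∈ L² ] (w p *ⁿ (same p p′ *ⁿ size))) +ⁿ (∑[ p ∈ L² ] ∑[ p′ ∈ L² ] (w p *ⁿ w p′))
      ≡⟨ cong₂ _+ⁿ_ (trans (∑-cong L² diagonal) (trans (∑-*ʳ L² size w) (ℕ.*-comm W size))) (∑-*∑ L² L² w w) ⟩
    size *ⁿ W +ⁿ W *ⁿ W ∎
    where
    open ℕ.≤-Reasoning
    on : Carrier → Carrier → Carrier × Carrier → ℕ
    on l t (x , b) = δ (x + t) (l * x + b)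
    same : Carrier × Carrier → Carrier × Carrier → ℕ
    same (x , b) (x′ , b′) = δ x x′ *ⁿ δ b b′
    regroup : ∀ a b c d → a *ⁿ b *ⁿ (c *ⁿ d) ≡ a *ⁿ c *ⁿ (b *ⁿ d)
    regroup = solve-∀
    diagonal : ∀ p → ∑[ p′ ∈ L² ] (w p *ⁿ (same p p′ *ⁿ size)) ≡ w p *ⁿ size
    diagonal p@(x , b) = trans (∑-*ˡ L² (w p) _) (cong (w p *ⁿ_) (trans (∑-*ʳ L² size (same p))
      (trans (cong (_*ⁿ size) (trans (∑-cartesianProduct L L _) (trans (∑-*∑ L L (δ x) (δ b)) (cong₂ _*ⁿ_ (∑-δ≡1 x) (∑-δ≡1 b)))))
        (ℕ.*-identityˡ size))))
    pair≤ : ∀ p p′ → w p *ⁿ w p′ *ⁿ (∑[ l ∈ L ] ∑[ t ∈ L ] (on l t p *ⁿ on l t p′)) ≤ⁿ w p *ⁿ (same p p′ *ⁿ size) +ⁿ w p *ⁿ w p′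
    pair≤ p@(x , b) p′@(x′ , b′) = begin
      w p *ⁿ w p′ *ⁿ (∑[ l ∈ L ] ∑[ t ∈ L ] (on l t p *ⁿ on l t p′))
        ≤⟨ ℕ.*-monoʳ-≤ (w p *ⁿ w p′) (∑-two-lines x b x′ b′) ⟩
      w p *ⁿ w p′ *ⁿ (δ x x′ *ⁿ (δ b b′ *ⁿ size) +ⁿ 1)
        ≡⟨ expand (w p) (w p′) (δ x x′) (δ b b′) size ⟩
      w p′ *ⁿ (w p *ⁿ (same p p′ *ⁿ size)) +ⁿ w p *ⁿ w p′
        ≤⟨ ℕ.+-monoˡ-≤ _ (ℕ.*-monoˡ-≤ _ (w≤1 p′)) ⟩
      1 *ⁿ (w p *ⁿ (same p p′ *ⁿ size)) +ⁿ w p *ⁿ w p′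
        ≡⟨ cong (_+ⁿ w p *ⁿ w p′) (ℕ.*-identityˡ _) ⟩
      w p *ⁿ (same p p′ *ⁿ size) +ⁿ w p *ⁿ w p′ ∎
      where
      expand : ∀ a c s t q → a *ⁿ c *ⁿ (s *ⁿ (t *ⁿ q) +ⁿ 1) ≡ c *ⁿ (a *ⁿ (s *ⁿ t *ⁿ q)) +ⁿ a *ⁿ c
      expand = solve-∀

-- Second moments about the mean.

-- Both sides moved so that no subtraction occurs: (a − b)² ≥ 0 when 𝟙 c = 0, equality when 𝟙 c = 1.
𝟙-complete-square : ∀ c a b → 𝟙 c *ⁿ (a *ⁿ a +ⁿ b *ⁿ b) +ⁿ 2 *ⁿ (a *ⁿ b) ≤ⁿ a *ⁿ a +ⁿ b *ⁿ b +ⁿ 𝟙 c *ⁿ (2 *ⁿ (a *ⁿ b))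
𝟙-complete-square true  a b = ℕ.≤-reflexive (cong₂ _+ⁿ_ (ℕ.*-identityˡ (a *ⁿ a +ⁿ b *ⁿ b)) (sym (ℕ.*-identityˡ (2 *ⁿ (a *ⁿ b)))))
𝟙-complete-square false a b = ℕ.≤-trans (2ab≤a²+b² a b) (ℕ.≤-reflexive (sym (ℕ.+-identityʳ _)))

-- The subtraction-free form of (q h)² ≤ 2 q h s + (q h′ − s)².
square-above-mean : ∀ q s {h h′} → h ≤ⁿ h′
  → q *ⁿ q *ⁿ (h *ⁿ h) +ⁿ 2 *ⁿ (q *ⁿ s) *ⁿ h′ ≤ⁿ 2 *ⁿ (q *ⁿ s) *ⁿ h +ⁿ q *ⁿ q *ⁿ (h′ *ⁿ h′) +ⁿ s *ⁿ s
square-above-mean q s {h} h≤h′ with k , refl ← ℕ.m≤n⇒∃[o]m+o≡n h≤h′ = begin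
  q *ⁿ q *ⁿ (h *ⁿ h) +ⁿ 2 *ⁿ (q *ⁿ s) *ⁿ (h +ⁿ k)
    ≡⟨ expandˡ q s h k ⟩
  q *ⁿ q *ⁿ (h *ⁿ h) +ⁿ 2 *ⁿ (q *ⁿ s) *ⁿ h +ⁿ 2 *ⁿ (q *ⁿ k *ⁿ s)
    -- With h′ = h + k, the two sides of the claim differ by (q k - s)² + 2 q² h k.
    ≤⟨ ℕ.+-monoʳ-≤ (q *ⁿ q *ⁿ (h *ⁿ h) +ⁿ 2 *ⁿ (q *ⁿ s) *ⁿ h) (2ab≤a²+b² (q *ⁿ k) s) ⟩
  q *ⁿ q *ⁿ (h *ⁿ h) +ⁿ 2 *ⁿ (q *ⁿ s) *ⁿ h +ⁿ (q *ⁿ k *ⁿ (q *ⁿ k) +ⁿ s *ⁿ s)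
    ≤⟨ ℕ.m≤m+n _ (2 *ⁿ (q *ⁿ q *ⁿ (h *ⁿ k))) ⟩
  q *ⁿ q *ⁿ (h *ⁿ h) +ⁿ 2 *ⁿ (q *ⁿ s) *ⁿ h +ⁿ (q *ⁿ k *ⁿ (q *ⁿ k) +ⁿ s *ⁿ s) +ⁿ 2 *ⁿ (q *ⁿ q *ⁿ (h *ⁿ k))
    ≡⟨ expandʳ q s h k ⟩
  2 *ⁿ (q *ⁿ s) *ⁿ h +ⁿ q *ⁿ q *ⁿ ((h +ⁿ k) *ⁿ (h +ⁿ k)) +ⁿ s *ⁿ s ∎
  where
  open ℕ.≤-Reasoning
  expandˡ : ∀ q s h k → q *ⁿ q *ⁿ (h *ⁿ h) +ⁿ 2 *ⁿ (q *ⁿ s) *ⁿ (h +ⁿ k) ≡ q *ⁿ q *ⁿ (h *ⁿ h) +ⁿ 2 *ⁿ (q *ⁿ s) *ⁿ h +ⁿ 2 *ⁿ (q *ⁿ k *ⁿ s)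
  expandˡ = solve-∀
  expandʳ : ∀ q s h k → q *ⁿ q *ⁿ (h *ⁿ h) +ⁿ 2 *ⁿ (q *ⁿ s) *ⁿ h +ⁿ (q *ⁿ k *ⁿ (q *ⁿ k) +ⁿ s *ⁿ s) +ⁿ 2 *ⁿ (q *ⁿ q *ⁿ (h *ⁿ k))
    ≡ 2 *ⁿ (q *ⁿ s) *ⁿ h +ⁿ q *ⁿ q *ⁿ ((h +ⁿ k) *ⁿ (h +ⁿ k)) +ⁿ s *ⁿ s
  expandʳ = solve-∀

module SecondMoment (F : FiniteField) (A B : FiniteField.Carrier F → Bool)
  (B⇒A : ∀ x → B x ≡ true → A x ≡ true) (B⇒≢0 : ∀ x → B x ≡ true → x ≢ FiniteField.0# F) where
  open NonzeroProducts F A B B⇒A B⇒≢0 public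

  S : ℕ
  S = ∑[ l ∈ L ] ∑[ t ∈ L ] (α t *ⁿ (u l t *ⁿ u l t))

  -- The mean of u is W/q, and only its deviation from the mean is extended from t ∈ A to all t.
  S≤ : size *ⁿ size *ⁿ S ≤ⁿ size *ⁿ size *ⁿ size *ⁿ W +ⁿ size *ⁿ n *ⁿ (W *ⁿ W)
  -- The cancelled q n W² + 2 q² W² appears on both sides once the negative terms of α (v - W)² ≤ (v
  -- - W)² have changed sides.
  S≤ = ℕ.+-cancelʳ-≤ (size *ⁿ n *ⁿ (W *ⁿ W) +ⁿ 2 *ⁿ (size *ⁿ W *ⁿ (size *ⁿ W))) _ _ (begin
    size *ⁿ size *ⁿ S +ⁿ (size *ⁿ n *ⁿ (W *ⁿ W) +ⁿ 2 *ⁿ (size *ⁿ W *ⁿ (size *ⁿ W)))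
      ≡⟨ lhs ⟨
    ∑[ l ∈ L ] ∑[ t ∈ L ] (α t *ⁿ (v l t *ⁿ v l t +ⁿ W *ⁿ W) +ⁿ 2 *ⁿ (v l t *ⁿ W))
      ≤⟨ ∑-mono L (λ l → ∑-mono L (λ t → 𝟙-complete-square (A t) (v l t) W)) ⟩
    ∑[ l ∈ L ] ∑[ t ∈ L ] (v l t *ⁿ v l t +ⁿ W *ⁿ W +ⁿ α t *ⁿ (2 *ⁿ (v l t *ⁿ W)))
      ≡⟨ rhs ⟩
    size *ⁿ size *ⁿ (∑[ l ∈ L ] ∑[ t ∈ L ] (u l t *ⁿ u l t)) +ⁿ size *ⁿ (size *ⁿ (W *ⁿ W)) +ⁿ 2 *ⁿ (size *ⁿ W) *ⁿ ∑ L H′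
      ≤⟨ ℕ.+-mono-≤ (ℕ.+-monoˡ-≤ _ (ℕ.*-monoʳ-≤ (size *ⁿ size) ∑∑u²)) (ℕ.≤-reflexive (cong (2 *ⁿ (size *ⁿ W) *ⁿ_) ∑H′)) ⟩
    size *ⁿ size *ⁿ (size *ⁿ W +ⁿ W *ⁿ W) +ⁿ size *ⁿ (size *ⁿ (W *ⁿ W)) +ⁿ 2 *ⁿ (size *ⁿ W) *ⁿ (n *ⁿ W)
      ≡⟨ collect size W n ⟩
    size *ⁿ size *ⁿ size *ⁿ W +ⁿ size *ⁿ n *ⁿ (W *ⁿ W) +ⁿ (size *ⁿ n *ⁿ (W *ⁿ W) +ⁿ 2 *ⁿ (size *ⁿ W *ⁿ (size *ⁿ W))) ∎)
    where
    open ℕ.≤-Reasoning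
    -- Scaling u by q turns its mean W / q into the natural number W.
    v : Carrier → Carrier → ℕ
    v l t = size *ⁿ u l t
    ∑∑ : (Carrier → Carrier → ℕ) → ℕ
    ∑∑ f = ∑[ l ∈ L ] ∑[ t ∈ L ] f l t
    ∑∑-cong : ∀ {f g : Carrier → Carrier → ℕ} → (∀ l t → f l t ≡ g l t) → ∑∑ f ≡ ∑∑ g
    ∑∑-cong f≡g = ∑-cong L (λ l → ∑-cong L (f≡g l))
    ∑∑-+ : ∀ f g → ∑∑ (λ l t → f l t +ⁿ g l t) ≡ ∑∑ f +ⁿ ∑∑ g
    ∑∑-+ f g = trans (∑-cong L (λ l → ∑-+ L (f l) (g l))) (∑-+ L _ _)
    ∑∑-*ˡ : ∀ c f → ∑∑ (λ l t → c *ⁿ f l t) ≡ c *ⁿ ∑∑ f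
    ∑∑-*ˡ c f = trans (∑-cong L (λ l → ∑-*ˡ L c (f l))) (∑-*ˡ L c _)
    ∑-size : ∀ c → ∑[ l ∈ L ] c ≡ size *ⁿ c
    ∑-size c = trans (∑-const L c) (cong (_*ⁿ c) length-L)
    lhs : ∑∑ (λ l t → α t *ⁿ (v l t *ⁿ v l t +ⁿ W *ⁿ W) +ⁿ 2 *ⁿ (v l t *ⁿ W))
      ≡ size *ⁿ size *ⁿ S +ⁿ (size *ⁿ n *ⁿ (W *ⁿ W) +ⁿ 2 *ⁿ (size *ⁿ W *ⁿ (size *ⁿ W)))
    lhs = begin-equality
      ∑∑ (λ l t → α t *ⁿ (v l t *ⁿ v l t +ⁿ W *ⁿ W) +ⁿ 2 *ⁿ (v l t *ⁿ W))
        ≡⟨ ∑∑-cong (λ l t → expand (α t) size (u l t) W) ⟩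
      ∑∑ (λ l t → size *ⁿ size *ⁿ (α t *ⁿ (u l t *ⁿ u l t)) +ⁿ (W *ⁿ W *ⁿ α t +ⁿ 2 *ⁿ (size *ⁿ W) *ⁿ u l t))
        ≡⟨ trans (∑∑-+ _ _) (cong₂ _+ⁿ_ (∑∑-*ˡ (size *ⁿ size) _)
             (trans (∑∑-+ _ _) (cong₂ _+ⁿ_ (∑∑-*ˡ (W *ⁿ W) _) (∑∑-*ˡ (2 *ⁿ (size *ⁿ W)) u)))) ⟩
      size *ⁿ size *ⁿ S +ⁿ (W *ⁿ W *ⁿ (∑[ l ∈ L ] n) +ⁿ 2 *ⁿ (size *ⁿ W) *ⁿ ∑∑ u)
        ≡⟨ cong (size *ⁿ size *ⁿ S +ⁿ_) (trans
             (cong₂ _+ⁿ_ (cong (W *ⁿ W *ⁿ_) (∑-size n)) (cong (2 *ⁿ (size *ⁿ W) *ⁿ_) ∑∑u))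
             (tidy size W n)) ⟩
      size *ⁿ size *ⁿ S +ⁿ (size *ⁿ n *ⁿ (W *ⁿ W) +ⁿ 2 *ⁿ (size *ⁿ W *ⁿ (size *ⁿ W))) ∎
      where
      expand : ∀ a q v W → a *ⁿ (q *ⁿ v *ⁿ (q *ⁿ v) +ⁿ W *ⁿ W) +ⁿ 2 *ⁿ (q *ⁿ v *ⁿ W)
        ≡ q *ⁿ q *ⁿ (a *ⁿ (v *ⁿ v)) +ⁿ (W *ⁿ W *ⁿ a +ⁿ 2 *ⁿ (q *ⁿ W) *ⁿ v)
      expand = solve-∀
      tidy : ∀ q W n → W *ⁿ W *ⁿ (q *ⁿ n) +ⁿ 2 *ⁿ (q *ⁿ W) *ⁿ (q *ⁿ W) ≡ q *ⁿ n *ⁿ (W *ⁿ W) +ⁿ 2 *ⁿ (q *ⁿ W *ⁿ (q *ⁿ W))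
      tidy = solve-∀
    rhs : ∑∑ (λ l t → v l t *ⁿ v l t +ⁿ W *ⁿ W +ⁿ α t *ⁿ (2 *ⁿ (v l t *ⁿ W)))
      ≡ size *ⁿ size *ⁿ ∑∑ (λ l t → u l t *ⁿ u l t) +ⁿ size *ⁿ (size *ⁿ (W *ⁿ W)) +ⁿ 2 *ⁿ (size *ⁿ W) *ⁿ ∑ L H′
    rhs = begin-equality
      ∑∑ (λ l t → v l t *ⁿ v l t +ⁿ W *ⁿ W +ⁿ α t *ⁿ (2 *ⁿ (v l t *ⁿ W)))
        ≡⟨ ∑∑-cong (λ l t → expand (α t) size (u l t) W) ⟩
      ∑∑ (λ l t → size *ⁿ size *ⁿ (u l t *ⁿ u l t) +ⁿ W *ⁿ W +ⁿ 2 *ⁿ (size *ⁿ W) *ⁿ (α t *ⁿ u l t))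
        ≡⟨ trans (∑∑-+ _ _) (cong₂ _+ⁿ_
             (trans (∑∑-+ _ _) (cong₂ _+ⁿ_ (∑∑-*ˡ (size *ⁿ size) _) (trans (∑-cong L (λ l → ∑-size (W *ⁿ W))) (∑-size _))))
             (∑∑-*ˡ (2 *ⁿ (size *ⁿ W)) _)) ⟩
      size *ⁿ size *ⁿ ∑∑ (λ l t → u l t *ⁿ u l t) +ⁿ size *ⁿ (size *ⁿ (W *ⁿ W)) +ⁿ 2 *ⁿ (size *ⁿ W) *ⁿ ∑ L H′ ∎
      where
      expand : ∀ a q v W → q *ⁿ v *ⁿ (q *ⁿ v) +ⁿ W *ⁿ W +ⁿ a *ⁿ (2 *ⁿ (q *ⁿ v *ⁿ W))
        ≡ q *ⁿ q *ⁿ (v *ⁿ v) +ⁿ W *ⁿ W +ⁿ 2 *ⁿ (q *ⁿ W) *ⁿ (a *ⁿ v)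
      expand = solve-∀
    collect : ∀ q W n → q *ⁿ q *ⁿ (q *ⁿ W +ⁿ W *ⁿ W) +ⁿ q *ⁿ (q *ⁿ (W *ⁿ W)) +ⁿ 2 *ⁿ (q *ⁿ W) *ⁿ (n *ⁿ W)
      ≡ q *ⁿ q *ⁿ q *ⁿ W +ⁿ q *ⁿ n *ⁿ (W *ⁿ W) +ⁿ (q *ⁿ n *ⁿ (W *ⁿ W) +ⁿ 2 *ⁿ (q *ⁿ W *ⁿ (q *ⁿ W)))
    collect = solve-∀

  ∑H′² : ∑[ l ∈ L ] (H′ l *ⁿ H′ l) ≤ⁿ n *ⁿ S
  ∑H′² = ℕ.≤-trans (∑-mono L (λ l → cauchy-schwarz L α (u l))) (ℕ.≤-reflexive (∑-*ˡ L n _))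

  -- Sum `square-above-mean` over l with s = n W, so that s / q is the mean of H′. By `∑H′²` and
  -- `S≤`, q² Σ H′² ≤ q³ s + q s², so the deviation of H′ costs only q³ s; the linear term 2 q s Σ H
  -- is controlled by the energy.
  ∑H²≤ : size *ⁿ size *ⁿ (∑[ l ∈ L ] (H l *ⁿ H l))
    ≤ⁿ 2 *ⁿ (size *ⁿ (n *ⁿ W)) *ⁿ addEnergy F A +ⁿ size *ⁿ size *ⁿ size *ⁿ (n *ⁿ W)
  -- On the left 2 q s² is the term with Σ H′ = s; on the right one half comes from `variance` and
  -- the other from summing s² over l.
  ∑H²≤ = ℕ.+-cancelʳ-≤ (2 *ⁿ (size *ⁿ s) *ⁿ s) _ _ (begin
    size *ⁿ size *ⁿ (∑[ l ∈ L ] (H l *ⁿ H l)) +ⁿ 2 *ⁿ (size *ⁿ s) *ⁿ s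
      ≡⟨ trans (∑-+ L _ _) (cong₂ _+ⁿ_ (∑-*ˡ L (size *ⁿ size) _)
           (trans (∑-*ˡ L (2 *ⁿ (size *ⁿ s)) H′) (cong (2 *ⁿ (size *ⁿ s) *ⁿ_) ∑H′))) ⟨
    ∑[ l ∈ L ] (size *ⁿ size *ⁿ (H l *ⁿ H l) +ⁿ 2 *ⁿ (size *ⁿ s) *ⁿ H′ l)
      ≤⟨ ∑-mono L (λ l → square-above-mean size s (H≤H′ l)) ⟩
    ∑[ l ∈ L ] (2 *ⁿ (size *ⁿ s) *ⁿ H l +ⁿ size *ⁿ size *ⁿ (H′ l *ⁿ H′ l) +ⁿ s *ⁿ s)
      ≡⟨ trans (∑-+ L _ _) (cong₂ _+ⁿ_
           (trans (∑-+ L _ _) (cong₂ _+ⁿ_ (∑-*ˡ L (2 *ⁿ (size *ⁿ s)) H) (∑-*ˡ L (size *ⁿ size) _)))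
           (trans (∑-const L (s *ⁿ s)) (cong (_*ⁿ (s *ⁿ s)) length-L))) ⟩
    2 *ⁿ (size *ⁿ s) *ⁿ ∑ L H +ⁿ size *ⁿ size *ⁿ (∑[ l ∈ L ] (H′ l *ⁿ H′ l)) +ⁿ size *ⁿ (s *ⁿ s)
      ≤⟨ ℕ.+-monoˡ-≤ _ (ℕ.+-mono-≤ (ℕ.*-monoʳ-≤ (2 *ⁿ (size *ⁿ s)) ∑H≤addEnergy) variance) ⟩
    2 *ⁿ (size *ⁿ s) *ⁿ addEnergy F A +ⁿ n *ⁿ (size *ⁿ size *ⁿ size *ⁿ W +ⁿ size *ⁿ n *ⁿ (W *ⁿ W)) +ⁿ size *ⁿ (s *ⁿ s)
      ≡⟨ collect size n W (addEnergy F A) ⟩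
    2 *ⁿ (size *ⁿ s) *ⁿ addEnergy F A +ⁿ size *ⁿ size *ⁿ size *ⁿ s +ⁿ 2 *ⁿ (size *ⁿ s) *ⁿ s ∎)
    where
    open ℕ.≤-Reasoning
    s = n *ⁿ W
    variance : size *ⁿ size *ⁿ (∑[ l ∈ L ] (H′ l *ⁿ H′ l)) ≤ⁿ n *ⁿ (size *ⁿ size *ⁿ size *ⁿ W +ⁿ size *ⁿ n *ⁿ (W *ⁿ W))
    variance = begin
      size *ⁿ size *ⁿ (∑[ l ∈ L ] (H′ l *ⁿ H′ l))                ≤⟨ ℕ.*-monoʳ-≤ (size *ⁿ size) ∑H′² ⟩
      size *ⁿ size *ⁿ (n *ⁿ S)                                   ≡⟨ swap (size *ⁿ size) n S ⟩
      n *ⁿ (size *ⁿ size *ⁿ S)                                   ≤⟨ ℕ.*-monoʳ-≤ n S≤ ⟩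
      n *ⁿ (size *ⁿ size *ⁿ size *ⁿ W +ⁿ size *ⁿ n *ⁿ (W *ⁿ W))  ∎
      where
      swap : ∀ a b c → a *ⁿ (b *ⁿ c) ≡ b *ⁿ (a *ⁿ c)
      swap = solve-∀
    collect : ∀ q n W E → 2 *ⁿ (q *ⁿ (n *ⁿ W)) *ⁿ E +ⁿ n *ⁿ (q *ⁿ q *ⁿ q *ⁿ W +ⁿ q *ⁿ n *ⁿ (W *ⁿ W)) +ⁿ q *ⁿ (n *ⁿ W *ⁿ (n *ⁿ W))
      ≡ 2 *ⁿ (q *ⁿ (n *ⁿ W)) *ⁿ E +ⁿ q *ⁿ q *ⁿ q *ⁿ (n *ⁿ W) +ⁿ 2 *ⁿ (q *ⁿ (n *ⁿ W)) *ⁿ (n *ⁿ W)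
    collect = solve-∀

  -- With W = m n, the bounds W⁴ ≤ P Σ H² and `∑H²≤` combine, after multiplication by q², into an
  -- inequality whose two sides share the factor q m n².
  growth : .{{_ : NonZero size}} .{{_ : NonZero m}} .{{_ : NonZero n}}
    → size *ⁿ (m *ⁿ m *ⁿ m *ⁿ (n *ⁿ n)) ≤ⁿ cardProd F A *ⁿ (2 *ⁿ addEnergy F A +ⁿ size *ⁿ size)
  growth = ℕ.*-cancelˡ-≤ (size *ⁿ (m *ⁿ (n *ⁿ n))) {{nonZero}} (begin
    size *ⁿ (m *ⁿ (n *ⁿ n)) *ⁿ (size *ⁿ (m *ⁿ m *ⁿ m *ⁿ (n *ⁿ n)))
      ≡⟨ factorˡ size m n ⟩
    size *ⁿ size *ⁿ (m *ⁿ n *ⁿ (m *ⁿ n) *ⁿ (m *ⁿ n *ⁿ (m *ⁿ n)))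
      ≡⟨ cong (λ v → size *ⁿ size *ⁿ (v *ⁿ v *ⁿ (v *ⁿ v))) W≡m*n ⟨
    size *ⁿ size *ⁿ (W *ⁿ W *ⁿ (W *ⁿ W))
      ≤⟨ ℕ.*-monoʳ-≤ (size *ⁿ size) (ℕ.≤-trans W⁴≤cardProd*collisions (ℕ.*-monoʳ-≤ P collisions≤∑H²)) ⟩
    size *ⁿ size *ⁿ (P *ⁿ (∑[ l ∈ L ] (H l *ⁿ H l)))
      ≡⟨ swap (size *ⁿ size) P _ ⟩
    P *ⁿ (size *ⁿ size *ⁿ (∑[ l ∈ L ] (H l *ⁿ H l)))
      ≤⟨ ℕ.*-monoʳ-≤ P ∑H²≤ ⟩
    P *ⁿ (2 *ⁿ (size *ⁿ (n *ⁿ W)) *ⁿ E +ⁿ size *ⁿ size *ⁿ size *ⁿ (n *ⁿ W))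
      ≡⟨ cong (λ v → P *ⁿ (2 *ⁿ (size *ⁿ (n *ⁿ v)) *ⁿ E +ⁿ size *ⁿ size *ⁿ size *ⁿ (n *ⁿ v))) W≡m*n ⟩
    P *ⁿ (2 *ⁿ (size *ⁿ (n *ⁿ (m *ⁿ n))) *ⁿ E +ⁿ size *ⁿ size *ⁿ size *ⁿ (n *ⁿ (m *ⁿ n)))
      ≡⟨ factorʳ size m n P E ⟩
    size *ⁿ (m *ⁿ (n *ⁿ n)) *ⁿ (P *ⁿ (2 *ⁿ E +ⁿ size *ⁿ size)) ∎)
    where
    open ℕ.≤-Reasoning
    P = cardProd F A
    E = addEnergy F A
    nonZero : NonZero (size *ⁿ (m *ⁿ (n *ⁿ n)))
    nonZero = ℕ.m*n≢0 size _ {{it}} {{ℕ.m*n≢0 m _ {{it}} {{ℕ.m*n≢0 n n}}}}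
    swap : ∀ a b c → a *ⁿ (b *ⁿ c) ≡ b *ⁿ (a *ⁿ c)
    swap = solve-∀
    factorˡ : ∀ q m n → q *ⁿ (m *ⁿ (n *ⁿ n)) *ⁿ (q *ⁿ (m *ⁿ m *ⁿ m *ⁿ (n *ⁿ n)))
      ≡ q *ⁿ q *ⁿ (m *ⁿ n *ⁿ (m *ⁿ n) *ⁿ (m *ⁿ n *ⁿ (m *ⁿ n)))
    factorˡ = solve-∀
    factorʳ : ∀ q m n P E → P *ⁿ (2 *ⁿ (q *ⁿ (n *ⁿ (m *ⁿ n))) *ⁿ E +ⁿ q *ⁿ q *ⁿ q *ⁿ (n *ⁿ (m *ⁿ n)))
      ≡ q *ⁿ (m *ⁿ (n *ⁿ n)) *ⁿ (P *ⁿ (2 *ⁿ E +ⁿ q *ⁿ q))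
    factorʳ = solve-∀

-- Degenerate sets and the bound in natural numbers.

size≢0 : ∀ F → NonZero (FiniteField.size F)
size≢0 F = Fin⇒NonZero (Inverse.from (FiniteField.enum F) (FiniteField.0# F))
  where
  Fin⇒NonZero : ∀ {k} → Fin k → NonZero k
  Fin⇒NonZero {suc k} _ = _

-- This is for A = {0}, where removing 0 leaves nothing. `Products` is therefore taken with B equal
-- to A, and W⁴ ≥ 1 forces both factors of its upper bound to be positive.
cardProd-positive : ∀ F A → 1 ≤ⁿ card F A → 1 ≤ⁿ cardProd F A
cardProd-positive F A 1≤card =
  1≤m*n⇒1≤m (cardProd F A) collisions (ℕ.≤-trans (ℕ.*-mono-≤ 1≤W² 1≤W²) W⁴≤cardProd*collisions)
  where
  open Products F A A (λ _ Ax → Ax)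
  1≤n : 1 ≤ⁿ n
  1≤n = subst (1 ≤ⁿ_) (card≡∑ A) 1≤card
  1≤W : 1 ≤ⁿ W
  1≤W = ℕ.≤-trans (ℕ.*-mono-≤ 1≤n 1≤n) (ℕ.≤-reflexive (sym W≡m*n))
  1≤W² : 1 ≤ⁿ W *ⁿ W
  1≤W² = ℕ.*-mono-≤ 1≤W 1≤W

-- The constant is 24 = 8 · 3: the 8 comes from n³ ≤ (2 m)³, and the 3 from 2 E + q², since K E and
-- K q² are both at most n³.
bound-from-growth : ∀ k d q n m P E → .{{_ : NonZero n}} → n ≤ⁿ 2 *ⁿ m
  → q *ⁿ (m *ⁿ m *ⁿ m *ⁿ (n *ⁿ n)) ≤ⁿ P *ⁿ (2 *ⁿ E +ⁿ q *ⁿ q)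
  → k *ⁿ E ≤ⁿ n *ⁿ n *ⁿ n *ⁿ d → k *ⁿ (q *ⁿ q) ≤ⁿ n *ⁿ n *ⁿ n *ⁿ d
  → k *ⁿ (q *ⁿ (n *ⁿ n)) ≤ⁿ 24 *ⁿ P *ⁿ d
bound-from-growth k d q n m P E n≤2m grow energy large =
  ℕ.*-cancelˡ-≤ (n *ⁿ n *ⁿ n) {{ℕ.m*n≢0 (n *ⁿ n) n {{ℕ.m*n≢0 n n}}}} (begin
    n *ⁿ n *ⁿ n *ⁿ (k *ⁿ (q *ⁿ (n *ⁿ n)))
      ≤⟨ ℕ.*-monoˡ-≤ _ (ℕ.*-mono-≤ (ℕ.*-mono-≤ n≤2m n≤2m) n≤2m) ⟩
    2 *ⁿ m *ⁿ (2 *ⁿ m) *ⁿ (2 *ⁿ m) *ⁿ (k *ⁿ (q *ⁿ (n *ⁿ n)))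
      ≡⟨ pull-k k q n m ⟩
    8 *ⁿ k *ⁿ (q *ⁿ (m *ⁿ m *ⁿ m *ⁿ (n *ⁿ n)))
      ≤⟨ ℕ.*-monoʳ-≤ (8 *ⁿ k) grow ⟩
    8 *ⁿ k *ⁿ (P *ⁿ (2 *ⁿ E +ⁿ q *ⁿ q))
      ≡⟨ push-k k q P E ⟩
    8 *ⁿ P *ⁿ (2 *ⁿ (k *ⁿ E) +ⁿ k *ⁿ (q *ⁿ q))
      ≤⟨ ℕ.*-monoʳ-≤ (8 *ⁿ P) (ℕ.+-mono-≤ (ℕ.*-monoʳ-≤ 2 energy) large) ⟩
    8 *ⁿ P *ⁿ (2 *ⁿ (n *ⁿ n *ⁿ n *ⁿ d) +ⁿ n *ⁿ n *ⁿ n *ⁿ d)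
      ≡⟨ collect (n *ⁿ n *ⁿ n) P d ⟩
    n *ⁿ n *ⁿ n *ⁿ (24 *ⁿ P *ⁿ d) ∎)
  where
  open ℕ.≤-Reasoning
  pull-k : ∀ k q n m → 2 *ⁿ m *ⁿ (2 *ⁿ m) *ⁿ (2 *ⁿ m) *ⁿ (k *ⁿ (q *ⁿ (n *ⁿ n))) ≡ 8 *ⁿ k *ⁿ (q *ⁿ (m *ⁿ m *ⁿ m *ⁿ (n *ⁿ n)))
  pull-k = solve-∀
  push-k : ∀ k q P E → 8 *ⁿ k *ⁿ (P *ⁿ (2 *ⁿ E +ⁿ q *ⁿ q)) ≡ 8 *ⁿ P *ⁿ (2 *ⁿ (k *ⁿ E) +ⁿ k *ⁿ (q *ⁿ q))
  push-k = solve-∀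
  collect : ∀ c P d → 8 *ⁿ P *ⁿ (2 *ⁿ (c *ⁿ d) +ⁿ c *ⁿ d) ≡ c *ⁿ (24 *ⁿ P *ⁿ d)
  collect = solve-∀

-- For |A| = 1 the size hypothesis reads K q² ≤ 1, so K q ≤ 1 ≤ P.
bound-singleton : ∀ k d q P → .{{_ : NonZero q}} → 1 ≤ⁿ P → k *ⁿ (q *ⁿ q) ≤ⁿ 1 *ⁿ d → k *ⁿ (q *ⁿ 1) ≤ⁿ 24 *ⁿ P *ⁿ d
bound-singleton k d q P 1≤P large = begin
  k *ⁿ (q *ⁿ 1)     ≤⟨ ℕ.*-monoʳ-≤ k (ℕ.*-monoʳ-≤ q (>-nonZero⁻¹ q)) ⟩
  k *ⁿ (q *ⁿ q)     ≤⟨ large ⟩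
  1 *ⁿ d            ≤⟨ ℕ.*-monoˡ-≤ d (ℕ.*-mono-≤ (s≤s {n = 23} z≤n) 1≤P) ⟩
  24 *ⁿ P *ⁿ d      ∎
  where open ℕ.≤-Reasoning

-- k / d plays the role of K.
growth-ℕ : ∀ (F : FiniteField) A k d → let q = FiniteField.size F; n = card F A in
  k *ⁿ addEnergy F A ≤ⁿ n *ⁿ n *ⁿ n *ⁿ d → k *ⁿ (q *ⁿ q) ≤ⁿ n *ⁿ n *ⁿ n *ⁿ d
  → k *ⁿ (q *ⁿ (n *ⁿ n)) ≤ⁿ 24 *ⁿ cardProd F A *ⁿ d
growth-ℕ F A k d = cases (card F A) m (card≡∑ A) refl n≤m+1
  where
  B : FiniteField.Carrier F → Bool
  B x = A x ∧ not (_==_ F x (FiniteField.0# F))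
  B⇒A : ∀ x → B x ≡ true → A x ≡ true
  B⇒A x Bx with A x
  ... | true = refl
  B⇒≢0 : ∀ x → B x ≡ true → x ≢ FiniteField.0# F
  B⇒≢0 x Bx with A x | FiniteField._≟_ F x (FiniteField.0# F)
  B⇒≢0 x () | true | yes _
  ... | true | no x≢0 = x≢0
  open SecondMoment F A B B⇒A B⇒≢0
  n≤m+1 : card F A ≤ⁿ m +ⁿ 1
  n≤m+1 = begin
    card F A                        ≡⟨ card≡∑ A ⟩
    n                               ≤⟨ ∑-mono L α≤β+δ ⟩
    ∑[ x ∈ L ] (β x +ⁿ δ 0# x)      ≡⟨ trans (∑-+ L β (δ 0#)) (cong (m +ⁿ_) (∑-δ≡1 0#)) ⟩
    m +ⁿ 1                          ∎
    where
    open ℕ.≤-Reasoning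
    α≤β+δ : ∀ x → α x ≤ⁿ β x +ⁿ δ 0# x
    α≤β+δ x with A x | x ≟ 0#
    ... | false | _       = z≤n
    ... | true  | no _    = s≤s z≤n
    ... | true  | yes x≡0 = ℕ.≤-reflexive (sym (δ-≡ (sym x≡0)))
  -- The cardinalities enter as variables c and b so that they can be matched on; the equations tie
  -- them back to n and m.
  cases : ∀ c b → c ≡ n → b ≡ m → c ≤ⁿ b +ⁿ 1
    → k *ⁿ addEnergy F A ≤ⁿ c *ⁿ c *ⁿ c *ⁿ d → k *ⁿ (size *ⁿ size) ≤ⁿ c *ⁿ c *ⁿ c *ⁿ d
    → k *ⁿ (size *ⁿ (c *ⁿ c)) ≤ⁿ 24 *ⁿ cardProd F A *ⁿ d
  cases zero    b       c≡n b≡m c≤b+1 energy large =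
    ℕ.≤-trans (ℕ.≤-reflexive (trans (cong (k *ⁿ_) (ℕ.*-zeroʳ size)) (ℕ.*-zeroʳ k))) z≤n
  -- Here m = 0 and n ≤ m + 1 leave n = 1, that is A = {0}.
  cases (suc c) zero    c≡n b≡m (s≤s z≤n) energy large =
    bound-singleton k d size (cardProd F A) {{size≢0 F}}
      (cardProd-positive F A (ℕ.≤-reflexive (trans c≡n (sym (card≡∑ A))))) large
  cases (suc c) (suc b) c≡n b≡m c≤b+1 energy large =
    bound-from-growth k d size (suc c) (suc b) (cardProd F A) (addEnergy F A)
      -- n ≤ m + 1 ≤ 2 m, as m ≥ 1 in this case.
      (ℕ.≤-trans c≤b+1 (ℕ.+-monoʳ-≤ (suc b) (s≤s z≤n)))
      (subst₂ (λ c b → size *ⁿ (b *ⁿ b *ⁿ b *ⁿ (c *ⁿ c)) ≤ⁿ cardProd F A *ⁿ (2 *ⁿ addEnergy F A +ⁿ size *ⁿ size)) (sym c≡n) (sym b≡m)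
        (growth {{size≢0 F}} {{subst NonZero b≡m _}} {{subst NonZero c≡n _}}))
      energy large

-- Passage to rational K.

open import Data.Rational using (ℚ; Positive; _≤_; _*_; mkℚ; toℚᵘ)

ℕ→ℚ-* : ∀ a b → ℕ→ℚ a * ℕ→ℚ b ≡ ℕ→ℚ (a *ⁿ b)
ℕ→ℚ-* a b = ℚ.toℚᵘ-injective (begin
  toℚᵘ (ℕ→ℚ a * ℕ→ℚ b)              ≈⟨ ℚ.toℚᵘ-homo-* (ℕ→ℚ a) (ℕ→ℚ b) ⟩
  toℚᵘ (ℕ→ℚ a) *ᵘ toℚᵘ (ℕ→ℚ b)      ≈⟨ ℚᵘ.*-cong (ℚ.toℚᵘ-fromℚᵘ (mkℚᵘ (ℤ.+ a) 0)) (ℚ.toℚᵘ-fromℚᵘ (mkℚᵘ (ℤ.+ b) 0)) ⟩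
  mkℚᵘ (ℤ.+ a ℤ.* ℤ.+ b) 0          ≡⟨ cong (λ z → mkℚᵘ z 0) (ℤ.pos-* a b) ⟨
  mkℚᵘ (ℤ.+ (a *ⁿ b)) 0             ≈⟨ ℚ.toℚᵘ-fromℚᵘ (mkℚᵘ (ℤ.+ (a *ⁿ b)) 0) ⟨
  toℚᵘ (ℕ→ℚ (a *ⁿ b))               ∎)
  where open ℚᵘ.≃-Reasoning

module ClearDenominator (k d : ℕ) .(coprime : Coprime k (suc d)) where
  K : ℚ
  K = mkℚ (ℤ.+ k) d coprime

  -- The comparison takes place in the unnormalised rationals, where k a over d + 1 may stay
  -- unreduced.
  K*≃ : ∀ a → toℚᵘ (K * ℕ→ℚ a) ≃ᵘ mkℚᵘ (ℤ.+ (k *ⁿ a)) d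
  K*≃ a = begin
    toℚᵘ (K * ℕ→ℚ a)                  ≈⟨ ℚ.toℚᵘ-homo-* K (ℕ→ℚ a) ⟩
    mkℚᵘ (ℤ.+ k) d *ᵘ toℚᵘ (ℕ→ℚ a)    ≈⟨ ℚᵘ.*-congˡ {mkℚᵘ (ℤ.+ k) d} (ℚ.toℚᵘ-fromℚᵘ (mkℚᵘ (ℤ.+ a) 0)) ⟩
    mkℚᵘ (ℤ.+ k) d *ᵘ mkℚᵘ (ℤ.+ a) 0  ≈⟨ *≡*ᵘ (cong₂ ℤ._*_ (sym (ℤ.pos-* k a)) (cong (λ c → ℤ.+ suc c) (sym (ℕ.*-identityʳ d)))) ⟩
    mkℚᵘ (ℤ.+ (k *ⁿ a)) d             ∎
    where open ℚᵘ.≃-Reasoning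

  clear : ∀ a b → K * ℕ→ℚ a ≤ ℕ→ℚ b → k *ⁿ a ≤ⁿ b *ⁿ suc d
  clear a b h with
    ℚᵘ.≤-respˡ-≃ (K*≃ a) (ℚᵘ.≤-respʳ-≃ (ℚ.toℚᵘ-fromℚᵘ (mkℚᵘ (ℤ.+ b) 0)) (ℚ.toℚᵘ-mono-≤ h))
  ... | *≤*ᵘ le = ℤ.drop‿+≤+ (subst₂ ℤ._≤_ (ℤ.*-identityʳ _) (sym (ℤ.pos-* b (suc d))) le)

  restore : ∀ a b → k *ⁿ a ≤ⁿ b *ⁿ suc d → K * ℕ→ℚ a ≤ ℕ→ℚ b
  restore a b h = ℚ.toℚᵘ-cancel-≤
    (ℚᵘ.≤-respˡ-≃ (ℚᵘ.≃-sym (K*≃ a)) (ℚᵘ.≤-respʳ-≃ (ℚᵘ.≃-sym (ℚ.toℚᵘ-fromℚᵘ (mkℚᵘ (ℤ.+ b) 0)))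
      (*≤*ᵘ (subst₂ ℤ._≤_ (sym (ℤ.*-identityʳ _)) (ℤ.pos-* b (suc d)) (ℤ.+≤+ h)))))

-- The condition |A| ≥ K^(1/3) q^(2/3) is cubed to K q² ≤ |A|³, which avoids roots. Rational K
-- suffices: for real K the hypotheses pass to every smaller positive rational, and the conclusion
-- passes to the limit.
theorem1p5 : Σ ℚ (λ C → Positive C × ((F : FiniteField) → (A : FiniteField.Carrier F → Bool) → (K : ℚ) → Positive K
    → K * ℕ→ℚ (addEnergy F A) ≤ ℕ→ℚ (card F A) * ℕ→ℚ (card F A) * ℕ→ℚ (card F A)
    → K * ℕ→ℚ (FiniteField.size F) * ℕ→ℚ (FiniteField.size F) ≤ ℕ→ℚ (card F A) * ℕ→ℚ (card F A) * ℕ→ℚ (card F A)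
    → K * ℕ→ℚ (FiniteField.size F) * ℕ→ℚ (cardAA0 F A) ≤ C * ℕ→ℚ (cardProd F A)))
theorem1p5 = ℕ→ℚ 24 , _ , bound
  where
  bound : (F : FiniteField) → (A : FiniteField.Carrier F → Bool) → (K : ℚ) → Positive K
    → K * ℕ→ℚ (addEnergy F A) ≤ ℕ→ℚ (card F A) * ℕ→ℚ (card F A) * ℕ→ℚ (card F A)
    → K * ℕ→ℚ (FiniteField.size F) * ℕ→ℚ (FiniteField.size F) ≤ ℕ→ℚ (card F A) * ℕ→ℚ (card F A) * ℕ→ℚ (card F A)
    → K * ℕ→ℚ (FiniteField.size F) * ℕ→ℚ (cardAA0 F A) ≤ ℕ→ℚ 24 * ℕ→ℚ (cardProd F A)
  -- Positivity excludes a negative numerator. The field d is the denominator minus one, hence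
  -- `suc d` below.
  bound F A (mkℚ (ℤ.+ k) d coprime) _ energy large =
    subst₂ _≤_ (sym (merge q (cardAA0 F A))) (sym (ℕ→ℚ-* 24 (cardProd F A)))
      (restore (q *ⁿ cardAA0 F A) (24 *ⁿ cardProd F A) (subst (λ c → k *ⁿ (q *ⁿ c) ≤ⁿ 24 *ⁿ cardProd F A *ⁿ suc d) (sym (FieldSums.cardAA0≡card² F A))
        (growth-ℕ F A k (suc d)
          (clear (addEnergy F A) (n *ⁿ n *ⁿ n) (subst (K * ℕ→ℚ (addEnergy F A) ≤_) cube energy))
          (clear (q *ⁿ q) (n *ⁿ n *ⁿ n) (subst₂ _≤_ (merge q q) cube large)))))
    where
    open ClearDenominator k d coprime
    q = FiniteField.size F
    n = card F A
    cube : ℕ→ℚ n * ℕ→ℚ n * ℕ→ℚ n ≡ ℕ→ℚ (n *ⁿ n *ⁿ n)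
    cube = trans (cong (_* ℕ→ℚ n) (ℕ→ℚ-* n n)) (ℕ→ℚ-* (n *ⁿ n) n)
    merge : ∀ a b → K * ℕ→ℚ a * ℕ→ℚ b ≡ K * ℕ→ℚ (a *ⁿ b)
    merge a b = trans (ℚ.*-assoc K (ℕ→ℚ a) (ℕ→ℚ b)) (cong (K *_) (ℕ→ℚ-* a b))
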